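{- Let $G=(V,E)$ be a finite DAG. The Euclidean closures of the open cones $\operatorname{cone}_G(C)$, for $C\in\mathbb{R}^E$ generic, together with their faces, form a complete polyhedral fan $\mathcal{F}_G$ in $\mathbb{R}^E$. The maximal cones of $\mathcal{F}_G$ are in bijection with the generic maxoids of $G$. Moreover, the function $\Phi$ which sends a cone of $\mathcal{F}_G$ to its maxoid is an inclusion-reversing surjection onto the set $\{\mathcal{M}_*(G,C):C\in\mathbb{R}^E\}$ of all maxoids of $G$: for all $F_1,F_2\in\mathcal{F}_G$, $$F_1\text{ is a face of }F_2\ \Longrightarrow\ \Phi(F_1)\supseteq\Phi(F_2).$$
   Context: Let $G=(V,E)$ be a finite DAG. $\mathbb{R}^E$ denotes the set of weight matrices supported on $G$: $V\times V$ matrices $C=(c_{ij})$ with $c_{ij}\in\mathbb{R}$ if $i\to j\in E$ and $c_{ij}=-\infty$ otherwise (identified with the Euclidean space indexed by $E$). For distinct $i,j\in V$, $P(i,j)$ is the set of directed paths from $i$ to $j$ in $G$, and the weight of a path $\pi$ is $\omega_C(\pi)=\sum_{e\in\pi}c_e$. A path in $P(i,j)$ is critical (for $(G,C)$) if its weight is maximal among all paths in $P(i,j)$. $C$ is generic if for all distinct $i,j$ with $P(i,j)\ne\emptyset$ there is exactly one critical path from $i$ to $j$. For $L\subseteq V$, the critical DAG $G^*_{C,L}$ is the DAG on $V$ with an edge $i\to j$ ($i\neq j$) if and only if $P(i,j)\neq\emptyset$ and no critical path from $i$ to $j$ in $(G,C)$ has an interior node in $L$. Distinct $i,j\in V\setminus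 L$ are $C^*$-connected given $L$ if $G^*_{C,L}$ contains, up to exchanging $i$ and $j$, a path of one of the forms (a) $i\to j$; (b) $i\leftarrow p\to j$; (c) $i\to \ell\leftarrow j$; (d) $i\leftarrow p\to\ell\leftarrow j$; (e) $i\leftarrow p\to\ell\leftarrow q\to j$, with $\ell\in L$ and $p,q\notin L$. Otherwise they are $C^*$-separated given $L$. For pairwise disjoint $I,J,L\subseteq V$, $I$ and $J$ are $C^*$-separated given $L$ if every $i\in I$ and $j\in J$ are $C^*$-separated given $L$. The maxoid $\mathcal{M}_*(G,C)$ is the set of all triples (CI statements) $[I\perp\!\!\!\perp J\mid L]$ with $I,J,L$ pairwise disjoint such that $I$ and $J$ are $C^*$-separated given $L$ in $(G,C)$. A generic maxoid of $G$ is one of the form $\mathcal{M}_*(G,C)$ with $C\in\mathbb{R}^E$ generic. For generic $C$, $\operatorname{cone}_G(C)=\{C'\in\mathbb{R}^E: C'\text{ generic},\ \mathcal{M}_*(G,C')=\mathcal{M}_*(G,C)\}$. A polyhedral cone is a finite intersection of closed linear half-spaces. A polyhedral fan is a finite collection of non-empty polyhedral cones closed under taking non-empty faces and such that any two cones intersect in a common face; it is complete if its cones cover the space. The maxoid of a cone $F\in\mathcal{F}_G$ is $\Phi(F)=\mathcal{M}_*(G,C)$ for $C$ in the relative interior of $F$ (it does not depend on the choice of $C$). -}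

module Defs where

open import Algebra.Bundles using (CommutativeRing)
import Algebra.Properties.Monoid.Sum as Sum
open import Data.Fin.Base using (Fin)
open import Data.Fin.Subset using (Subset; _∩_; Empty; _∈_; _∉_)
open import Data.List.Base using (List; []; _∷_)
open import Data.List.Relation.Unary.Any using (Any)
open import Data.Nat.Base using (ℕ)
open import Data.Product.Base using (Σ; ∃; ∃-syntax; _×_; _,_; proj₁; proj₂)
open import Data.Product using (∃!)
open import Data.Sum.Base using (_⊎_)
open import Data.Vec.Functional using (Vector)
open import Function.Definitions using (Injective)
open import Level using (0ℓ; suc; _⊔_)
open import Relation.Binary.Bundles using (Setoid)
open import Relation.Binary.Construct.Closure.ReflexiveTransitive
  using (Star; ε; _◅_)
open import Relation.Binary.Construct.Closure.Transitive using (TransClosure)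
open import Relation.Binary.Core using (Rel)
open import Relation.Binary.PropositionalEquality.Core using (_≡_; _≢_)
open import Relation.Binary.Structures using (IsTotalOrder)
open import Relation.Nullary.Negation using (¬_)
open import Relation.Unary using (Pred; Satisfiable; _⊆_; _≐_)
  renaming (_∩_ to _∩ᴾ_; _∈_ to _∈ᴾ_)

-- The real numbers are given by their categorical axiomatisation: a complete
-- totally ordered field, over a setoid equality so that concrete models
-- (Dedekind cuts, Cauchy sequences) are instances.  Completeness is the
-- classical least-upper-bound axiom, so it is meant to be read together with
-- excluded middle.

record RealNumbers : Set₁ where
  field
    commutativeRing : CommutativeRing 0ℓ 0ℓ

  open CommutativeRing commutativeRing public

  infix 4 _≤_ _<_
  field
    _≤_          : Rel Carrier 0ℓ
    isTotalOrder : IsTotalOrder _≈_ _≤_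
    0≉1          : ¬ (0# ≈ 1#)
    inverse      : ∀ x → ¬ (x ≈ 0#) → ∃[ y ] x * y ≈ 1#
    +-monoˡ-≤    : ∀ {x y} z → x ≤ y → x + z ≤ y + z
    *-nonNeg     : ∀ {x y} → 0# ≤ x → 0# ≤ y → 0# ≤ x * y

  UpperBound : Pred Carrier 0ℓ → Pred Carrier 0ℓ
  UpperBound S u = ∀ x → x ∈ᴾ S → x ≤ u

  field
    complete : (S : Pred Carrier 0ℓ) → Satisfiable S → Satisfiable (UpperBound S) →
               ∃[ s ] UpperBound S s × (∀ u → UpperBound S u → s ≤ u)

  _<_ : Rel Carrier 0ℓ
  x < y = x ≤ y × ¬ (x ≈ y)

-- Sets of points (and sets of CI statements) are predicates, compared
-- extensionally.

Sets : ∀ {A : Set} {ℓ} → Pred (Pred A 0ℓ) ℓ → Setoid (suc 0ℓ ⊔ ℓ) 0ℓ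
Sets {A} Q = record
  { Carrier       = Σ (Pred A 0ℓ) Q
  ; _≈_           = λ S T → proj₁ S ≐ proj₁ T
  ; isEquivalence = record
    { refl  = (λ x → x) , (λ x → x)
    ; sym   = λ (p , q) → q , p
    ; trans = λ (p , q) (r , s) → (λ x → r (p x)) , (λ x → q (s x))
    }
  }

module Polyhedral (ℝ : RealNumbers) (m : ℕ) where
  open RealNumbers ℝ
  open Sum +-monoid using (sum)

  Point : Set
  Point = Vector Carrier m

  _·_ : Point → Point → Carrier
  x · y = sum (λ e → x e * y e)

  -- ‖ x − y ‖ < r, for r > 0
  Near : Carrier → Point → Point → Set
  Near r x y = sum (λ e → (x e - y e) * (x e - y e)) < r * r

  closure : Pred Point 0ℓ → Pred Point 0ℓ
  closure S x = ∀ r → 0# < r → ∃[ y ] y ∈ᴾ S × Near r x y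

  affineHull : Pred Point 0ℓ → Pred Point 0ℓ
  affineHull S y =
    ∃[ k ] Σ (Vector Carrier k) λ c → Σ (Vector Point k) λ p →
      (∀ i → p i ∈ᴾ S) × sum c ≈ 1# × (∀ e → y e ≈ sum (λ i → c i * p i e))

  relint : Pred Point 0ℓ → Pred Point 0ℓ
  relint S x = x ∈ᴾ S ×
    ∃[ r ] 0# < r × (∀ y → y ∈ᴾ affineHull S → Near r x y → y ∈ᴾ S)

  IsPolyhedralCone : Pred Point 0ℓ → Set
  IsPolyhedralCone P =
    ∃[ k ] Σ (Vector Point k) λ a → P ≐ (λ x → ∀ i → 0# ≤ a i · x)

  -- The set where a valid inequality b ≤ a · x is tight; this may be empty,
  -- and a = 0, b = 0 yields P itself.
  IsFaceOf : Pred Point 0ℓ → Pred Point 0ℓ → Set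
  IsFaceOf F P = Σ Point λ a → ∃[ b ]
    (∀ x → x ∈ᴾ P → b ≤ a · x) × F ≐ (λ x → x ∈ᴾ P × a · x ≈ b)

  Family : Set₁
  Family = Pred (Pred Point 0ℓ) 0ℓ

  record IsCompleteFan (𝓕 : Family) : Set₁ where
    field
      finite     : ∃[ k ] Σ (Fin k → Pred Point 0ℓ) λ f →
                   (∀ i → f i ∈ᴾ 𝓕) × (∀ F → F ∈ᴾ 𝓕 → ∃[ i ] F ≐ f i)
      nonempty   : ∀ F → F ∈ᴾ 𝓕 → Satisfiable F
      polyhedral : ∀ F → F ∈ᴾ 𝓕 → IsPolyhedralCone F
      faces      : ∀ F P → P ∈ᴾ 𝓕 → Satisfiable F → IsFaceOf F P → F ∈ᴾ 𝓕
      intersect  : ∀ F F′ → F ∈ᴾ 𝓕 → F′ ∈ᴾ 𝓕 →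
                   IsFaceOf (F ∩ᴾ F′) F × IsFaceOf (F ∩ᴾ F′) F′
      covers     : ∀ x → ∃[ F ] F ∈ᴾ 𝓕 × x ∈ᴾ F

  IsMaximal : Family → Pred (Pred Point 0ℓ) (suc 0ℓ)
  IsMaximal 𝓕 F = F ∈ᴾ 𝓕 × (∀ F′ → F′ ∈ᴾ 𝓕 → F ⊆ F′ → F′ ⊆ F)

-- The edge set is an enumerated subset of V × V, where V = Fin n.

record DAG : Set where
  field
    n m       : ℕ
    edge      : Fin m → Fin n × Fin n
    edge-inj  : Injective _≡_ _≡_ edge

  V : Set
  V = Fin n

  infix 4 _⟶_
  _⟶_ : Rel V 0ℓ
  i ⟶ j = ∃[ e ] edge e ≡ (i , j)

  field
    acyclic : ∀ i → ¬ TransClosure _⟶_ i i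

  -- In a DAG every directed walk is a path.
  Path : Rel V 0ℓ
  Path = Star _⟶_

  interior : ∀ {i j} → Path i j → List V
  interior ε                           = []
  interior (_ ◅ ε)                     = []
  interior (_◅_ {j = k} _ π@(_ ◅ _))  = k ∷ interior π

module Maxoids (ℝ : RealNumbers) (G : DAG) where
  open RealNumbers ℝ using (Carrier; 0#; _+_; _≤_)
  open DAG G
  open Polyhedral ℝ m public

  -- A weight matrix supported on G is a point of ℝ^E; the entries −∞ at the
  -- non-edges carry no information.
  Weights : Set
  Weights = Point

  ω : Weights → ∀ {i j} → Path i j → Carrier
  ω C ε             = 0#
  ω C ((e , _) ◅ π) = C e + ω C π

  Critical : Weights → ∀ {i j} → Pred (Path i j) 0ℓ
  Critical C {i} {j} π = ∀ (π′ : Path i j) → ω C π′ ≤ ω C π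

  Generic : Pred Weights 0ℓ
  Generic C = ∀ i j → i ≢ j → Path i j → ∃! _≡_ (Critical C {i} {j})

  CriticalEdge : Weights → Subset n → Rel V 0ℓ
  CriticalEdge C L i j = i ≢ j × Path i j ×
    (∀ (π : Path i j) → Critical C π → ¬ Any (_∈ L) (interior π))

  data Connecting (C : Weights) (L : Subset n) (i j : V) : Set where
    type-a : CriticalEdge C L i j → Connecting C L i j
    type-b : ∀ p → p ∉ L →
             CriticalEdge C L p i → CriticalEdge C L p j → Connecting C L i j
    type-c : ∀ l → l ∈ L →
             CriticalEdge C L i l → CriticalEdge C L j l → Connecting C L i j
    type-d : ∀ p l → p ∉ L → l ∈ L →
             CriticalEdge C L p i → CriticalEdge C L p l →
             CriticalEdge C L j l → Connecting C L i j
    type-e : ∀ p l q → p ∉ L → l ∈ L → q ∉ L →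
             CriticalEdge C L p i → CriticalEdge C L p l →
             CriticalEdge C L q l → CriticalEdge C L q j → Connecting C L i j

  Connected : Weights → Subset n → Rel V 0ℓ
  Connected C L i j = Connecting C L i j ⊎ Connecting C L j i

  -- (I , J , L) stands for [ I ⫫ J ∣ L ].
  Triple : Set
  Triple = Subset n × Subset n × Subset n

  maxoid : Weights → Pred Triple 0ℓ
  maxoid C (I , J , L) =
    Empty (I ∩ J) × Empty (I ∩ L) × Empty (J ∩ L) ×
    (∀ i j → i ∈ I → j ∈ J → ¬ Connected C L i j)

  IsMaxoid : Pred (Pred Triple 0ℓ) 0ℓ
  IsMaxoid M = Σ Weights λ C → M ≐ maxoid C

  IsGenericMaxoid : Pred (Pred Triple 0ℓ) 0ℓ
  IsGenericMaxoid M = Σ Weights λ C → Generic C × M ≐ maxoid C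

  cone : Weights → Pred Weights 0ℓ
  cone C C′ = Generic C′ × maxoid C′ ≐ maxoid C

  -- Each closure is a face of itself.
  𝓕 : Family
  𝓕 F = Satisfiable F × Σ Weights λ C → Generic C × IsFaceOf F (closure (cone C))

  -- The maxoid of a cone.  As a union over the relative interior this makes
  -- sense for every set of weights; it is the common maxoid of the relative
  -- interior points exactly when these exist and agree, which is ΦWellDefined.
  Φ : Pred Weights 0ℓ → Pred Triple 0ℓ
  Φ F t = ∃[ C ] C ∈ᴾ relint F × t ∈ᴾ maxoid C

  ΦWellDefined : Set₁
  ΦWellDefined = ∀ F → F ∈ᴾ 𝓕 →
    Satisfiable (relint F) × (∀ C → C ∈ᴾ relint F → Φ F ≐ maxoid C)

{-# OPTIONS --safe #-}
module Submission where

-- For a weight vector x let Crit x be its set of critical paths and Cell x = { y : Crit x ⊆ Crit y }.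
-- Each Cell x is a polyhedral cone with relative interior { y : Crit y = Crit x }, and these cones form
-- the normal fan of a Minkowski sum of path polytopes: adding up the functionals "best path minus path"
-- exhibits Cell x ∩ Cell y as a face of Cell x, and a nonempty face of a cell is the cell of any of its
-- points with fewest critical paths.  A point with fewest critical paths among those whose cell contains
-- x is generic, since otherwise a small perturbation would separate two critical paths; hence every cell
-- is a face of a generic one.
--
-- The link with maxoids is that the maxoid of a generic C determines Crit C.  If π and π′ are the
-- critical paths from i to j for generic C and C′ with equal maxoids, conditioning on the ancestors of
-- j (other than i and j) that do not lie below the interior of π shows that the interior of π′ lies
-- below that of π.  By symmetry and acyclicity the first interior nodes agree, and one continues with
-- the tails.  So the closure of cone C is Cell C, and everything else is read off from Crit.

open import Defs
open import Axiom.ExcludedMiddle using (ExcludedMiddle)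
open import Data.Product using (_×_; Σ-syntax; proj₁)
open import Function.Bundles using (Bijection; Surjection)
open import Level using (0ℓ)
open import Relation.Unary using (_∈_; _⊇_; _≐_)

open import Algebra.Bundles using (RawRing)
import Algebra.Properties.CommutativeSemigroup as CommutativeSemigroupProperties
import Algebra.Properties.Ring as RingProperties
import Algebra.Properties.Semiring.Mult as SemiringMult
import Algebra.Properties.Semiring.Sum as SemiringSum
import Algebra.Solver.Ring as RingSolver
open import Algebra.Solver.Ring.AlmostCommutativeRing
  using (fromCommutativeRing; _-Raw-AlmostCommutative⟶_)
open import Data.Empty using (⊥-elim)
open import Data.Fin.Base using (Fin; zero; suc; combine; remQuot; funToFin; finToFun)
open import Data.Fin.Properties using (_≟_; remQuot-combine; finToFun-funToFin)
open import Data.Fin.Subset using (Subset; ∣_∣; ⁅_⁆) renaming (_∈_ to _∈ˢ_; _∉_ to _∉ˢ_)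
open import Data.Fin.Subset.Properties
  using (p⊂q⇒∣p∣<∣q∣; ∣p∣≤n; x∈⁅x⁆; x∈⁅y⁆⇒x≡y; x∈p∩q⁻)
open import Data.List.Base using (List; _++_; map; cartesianProductWith; allFin; length; lookup)
open import Data.List.Membership.Propositional using (find; lose) renaming (_∈_ to _∈ˡ_)
open import Data.List.Membership.Propositional.Properties
  using (∈-map⁺; ∈-++⁺ˡ; ∈-++⁺ʳ; ∈-cartesianProductWith⁺; ∈-allFin)
open import Data.List.Relation.Unary.Any using (Any; here; there; index)
open import Data.List.Relation.Unary.Any.Properties using (lookup-index)
open import Data.Maybe.Base using (Maybe; just; nothing)
open import Data.Nat.Base as ℕ using (ℕ; zero; suc)
import Data.Nat.Properties as ℕ
open import Data.Product using (_,_; ∃; ∃-syntax; proj₂)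
open import Data.Product.Properties using (≡-dec)
open import Data.Sum using (_⊎_; inj₁; inj₂)
open import Data.Vec.Base using (tabulate)
open import Data.Vec.Functional using (Vector)
open import Data.Vec.Properties using (lookup⇒[]=; []=⇒lookup; lookup∘tabulate)
open import Function.Base using (_∘_)
open import Relation.Binary.Construct.Closure.ReflexiveTransitive using (ε; _◅_; _◅◅_)
open import Relation.Binary.Construct.Closure.Transitive using (TransClosure; [_]; _∷_)
open import Relation.Binary.PropositionalEquality as ≡ using (_≡_; _≢_)
import Relation.Binary.Reasoning.Setoid as SetoidReasoning
open import Relation.Binary.Structures using (IsTotalOrder)
open import Relation.Nullary using (yes; no; ¬_; does)
open import Relation.Nullary.Decidable using (dec-true)
open import Relation.Unary using (Pred; Satisfiable; _⊆_) renaming (_∩_ to _∩ᴾ_)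
open import Relation.Unary.Properties using (≐-refl; ≐-sym; ≐-trans)

-- Ordered field arithmetic and properties of small positive numbers.

module OrderedField (em : ExcludedMiddle 0ℓ) (ℝ : RealNumbers) where
  open RealNumbers ℝ hiding (zero)
  open IsTotalOrder isTotalOrder using (total; antisym)
    renaming (refl to ≤-refl; reflexive to ≤-reflexive; trans to ≤-trans)
    public
  open SemiringMult semiring using (×-homo-+; ×1-homo-*) renaming (_×_ to _×ᵤ_)

  -- A pair (a , b) of naturals stands for the coefficient a − b; it is kept reduced because the
  -- solver compares normal forms by their coefficients.
  module Solver where
    reduce : ℕ × ℕ → ℕ × ℕ
    reduce (suc a , suc b) = reduce (a , b)
    reduce p               = p

    Coefficient : RawRing 0ℓ 0ℓ
    Coefficient = record
      { Carrier = ℕ × ℕ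
      ; _≈_     = _≡_
      ; _+_     = λ (a , b) (c , d) → reduce (a ℕ.+ c , b ℕ.+ d)
      ; _*_     = λ (a , b) (c , d) → reduce (a ℕ.* c ℕ.+ b ℕ.* d , a ℕ.* d ℕ.+ b ℕ.* c)
      ; -_      = λ (a , b) → b , a
      ; 0#      = 0 , 0
      ; 1#      = 1 , 0
      }

    ⟦_⟧ᶜ : ℕ × ℕ → Carrier
    ⟦ a , b ⟧ᶜ = a ×ᵤ 1# - b ×ᵤ 1#

    open RingProperties ring
    open SetoidReasoning setoid
    open CommutativeSemigroupProperties +-commutativeSemigroup using (interchange)

    -‿+-interchange : ∀ a b c d → (a + c) - (b + d) ≈ (a - b) + (c - d)
    -‿+-interchange a b c d = begin
      (a + c) - (b + d)     ≈⟨ +-congˡ (-‿+-comm b d) ⟨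
      (a + c) + (- b - d)   ≈⟨ interchange a c (- b) (- d) ⟩
      (a - b) + (c - d)     ∎

    ⟦reduce⟧ : ∀ p → ⟦ reduce p ⟧ᶜ ≈ ⟦ p ⟧ᶜ
    ⟦reduce⟧ (zero  , _)     = refl
    ⟦reduce⟧ (suc a , zero)  = refl
    ⟦reduce⟧ (suc a , suc b) = begin
      ⟦ reduce (a , b) ⟧ᶜ          ≈⟨ ⟦reduce⟧ (a , b) ⟩
      ⟦ a , b ⟧ᶜ                   ≈⟨ +-identityˡ _ ⟨
      0# + ⟦ a , b ⟧ᶜ              ≈⟨ +-congʳ (-‿inverseʳ 1#) ⟨
      (1# - 1#) + ⟦ a , b ⟧ᶜ       ≈⟨ -‿+-interchange 1# 1# (a ×ᵤ 1#) (b ×ᵤ 1#) ⟨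
      ⟦ suc a , suc b ⟧ᶜ           ∎

    *-homoᶜ : ∀ a b c d →
              ⟦ a ℕ.* c ℕ.+ b ℕ.* d , a ℕ.* d ℕ.+ b ℕ.* c ⟧ᶜ ≈ ⟦ a , b ⟧ᶜ * ⟦ c , d ⟧ᶜ
    *-homoᶜ a b c d = begin
      (a ℕ.* c ℕ.+ b ℕ.* d) ×ᵤ 1# - (a ℕ.* d ℕ.+ b ℕ.* c) ×ᵤ 1#
        ≈⟨ +-cong (split a c b d) (-‿cong (split a d b c)) ⟩
      (A * C + B * D) - (A * D + B * C)
        ≈⟨ -‿+-interchange (A * C) (A * D) (B * D) (B * C) ⟩
      (A * C - A * D) + (B * D - B * C)
        ≈⟨ +-cong (x[y-z]≈xy-xz A C D) flip ⟨
      A * (C - D) + (- B) * (C - D)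
        ≈⟨ distribʳ (C - D) A (- B) ⟨
      (A - B) * (C - D) ∎
      where
      A = a ×ᵤ 1#
      B = b ×ᵤ 1#
      C = c ×ᵤ 1#
      D = d ×ᵤ 1#
      split : ∀ m n k l → (m ℕ.* n ℕ.+ k ℕ.* l) ×ᵤ 1# ≈
              (m ×ᵤ 1#) * (n ×ᵤ 1#) + (k ×ᵤ 1#) * (l ×ᵤ 1#)
      split m n k l = trans (×-homo-+ 1# (m ℕ.* n) (k ℕ.* l))
                            (+-cong (×1-homo-* m n) (×1-homo-* k l))
      flip : (- B) * (C - D) ≈ B * D - B * C
      flip = begin
        (- B) * (C - D)          ≈⟨ x[y-z]≈xy-xz (- B) C D ⟩
        (- B) * C - (- B) * D    ≈⟨ +-cong (-‿distribˡ-* B C) (-‿cong (-‿distribˡ-* B D)) ⟨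
        - (B * C) - (- (B * D))  ≈⟨ +-congˡ (-‿involutive (B * D)) ⟩
        - (B * C) + B * D        ≈⟨ +-comm _ _ ⟩
        B * D - B * C            ∎

    morphism : Coefficient -Raw-AlmostCommutative⟶ fromCommutativeRing commutativeRing
    morphism = record
      { ⟦_⟧    = ⟦_⟧ᶜ
      ; +-homo = λ (a , b) (c , d) →
          trans (⟦reduce⟧ (a ℕ.+ c , b ℕ.+ d))
            (trans (+-cong (×-homo-+ 1# a c) (-‿cong (×-homo-+ 1# b d)))
                (-‿+-interchange (a ×ᵤ 1#) (b ×ᵤ 1#) (c ×ᵤ 1#) (d ×ᵤ 1#)))
      ; *-homo = λ (a , b) (c , d) →
          trans (⟦reduce⟧ (a ℕ.* c ℕ.+ b ℕ.* d , a ℕ.* d ℕ.+ b ℕ.* c)) (*-homoᶜ a b c d)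
      ; -‿homo = λ (a , b) →
          trans (+-comm (b ×ᵤ 1#) (- (a ×ᵤ 1#)))
            (trans (+-congˡ (sym (-‿involutive (b ×ᵤ 1#)))) (-‿+-comm (a ×ᵤ 1#) (- (b ×ᵤ 1#))))
      ; 0-homo = -‿inverseʳ 0#
      ; 1-homo = trans (+-congˡ -0#≈0#) (trans (+-identityʳ _) (+-identityʳ 1#))
      }

    _≟ᶜ_ : ∀ p q → Maybe (⟦ p ⟧ᶜ ≈ ⟦ q ⟧ᶜ)
    p ≟ᶜ q with ≡-dec ℕ._≟_ ℕ._≟_ p q
    ... | no _   = nothing
    ... | yes eq = just (reflexive (≡.cong ⟦_⟧ᶜ eq))

    open RingSolver Coefficient (fromCommutativeRing commutativeRing) morphism _≟ᶜ_ public
      using (solve; _:=_; _:+_; _:*_; _:-_; :-_)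

  open RingProperties ring using (x∙y⁻¹≈ε⇒x≈y; x≈y⇒x∙y⁻¹≈ε)
  open Solver using (solve; _:=_; _:+_; _:*_; _:-_; :-_)

  ≤-respˡ : ∀ {x y z} → x ≈ y → x ≤ z → y ≤ z
  ≤-respˡ x≈y x≤z = ≤-trans (≤-reflexive (sym x≈y)) x≤z

  ≤-respʳ : ∀ {x y z} → x ≈ y → z ≤ x → z ≤ y
  ≤-respʳ x≈y z≤x = ≤-trans z≤x (≤-reflexive x≈y)

  <-respʳ : ∀ {x y z} → x ≈ y → z < x → z < y
  <-respʳ x≈y (z≤x , z≉x) = ≤-respʳ x≈y z≤x , λ z≈y → z≉x (trans z≈y (sym x≈y))

  <⇒≱ : ∀ {x y} → x < y → ¬ y ≤ x
  <⇒≱ (x≤y , x≉y) y≤x = x≉y (antisym x≤y y≤x)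

  ≱⇒< : ∀ {x y} → ¬ y ≤ x → x < y
  ≱⇒< {x} {y} y≰x with total x y
  ... | inj₁ x≤y = x≤y , λ x≈y → y≰x (≤-reflexive (sym x≈y))
  ... | inj₂ y≤x = ⊥-elim (y≰x y≤x)

  ≤-or-< : ∀ x y → x ≤ y ⊎ y < x
  ≤-or-< x y with em {x ≤ y}
  ... | yes x≤y = inj₁ x≤y
  ... | no  x≰y = inj₂ (≱⇒< x≰y)

  <-≤-trans : ∀ {x y z} → x < y → y ≤ z → x < z
  <-≤-trans x<y y≤z = ≱⇒< λ z≤x → <⇒≱ x<y (≤-trans y≤z z≤x)

  ≤-<-trans : ∀ {x y z} → x ≤ y → y < z → x < z
  ≤-<-trans x≤y y<z = ≱⇒< λ z≤x → <⇒≱ y<z (≤-trans z≤x x≤y)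

  0≤y-x : ∀ {x y} → x ≤ y → 0# ≤ y - x
  0≤y-x {x} x≤y = ≤-respˡ (-‿inverseʳ x) (+-monoˡ-≤ (- x) x≤y)

  0<y-x : ∀ {x y} → x < y → 0# < y - x
  0<y-x {x} {y} (x≤y , x≉y) = 0≤y-x x≤y , λ 0≈y-x → x≉y (sym (x∙y⁻¹≈ε⇒x≈y y x (sym 0≈y-x)))

  ≤-from : ∀ {x y} d → 0# ≤ d → d ≈ y - x → x ≤ y
  ≤-from {x} {y} d 0≤d d≈y-x =
    ≤-respˡ (+-identityˡ x) (≤-respʳ (trans (+-congʳ d≈y-x) (solve 2 (λ x y → y :- x :+ x := y) refl x y))
      (+-monoˡ-≤ x 0≤d))

  +-nonNeg : ∀ {x y} → 0# ≤ x → 0# ≤ y → 0# ≤ x + y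
  +-nonNeg {x} {y} 0≤x 0≤y =
    ≤-trans 0≤y (≤-respˡ (+-identityˡ y) (+-monoˡ-≤ y 0≤x))

  +-mono-≤ : ∀ {x y u v} → x ≤ y → u ≤ v → x + u ≤ y + v
  +-mono-≤ {x} {y} {u} {v} x≤y u≤v = ≤-from _ (+-nonNeg (0≤y-x x≤y) (0≤y-x u≤v))
    (solve 4 (λ x y u v → (y :- x) :+ (v :- u) := (y :+ v) :- (x :+ u)) refl x y u v)

  *-monoˡ-≤ : ∀ {t x y} → 0# ≤ t → x ≤ y → t * x ≤ t * y
  *-monoˡ-≤ {t} {x} {y} 0≤t x≤y = ≤-from _ (*-nonNeg 0≤t (0≤y-x x≤y))
    (solve 3 (λ t x y → t :* (y :- x) := t :* y :- t :* x) refl t x y)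

  0≤x*x : ∀ x → 0# ≤ x * x
  0≤x*x x with total 0# x
  ... | inj₁ 0≤x = *-nonNeg 0≤x 0≤x
  ... | inj₂ x≤0 = ≤-respʳ (solve 1 (λ x → (:- x) :* (:- x) := x :* x) refl x) (*-nonNeg 0≤-x 0≤-x)
    where 0≤-x = ≤-respʳ (+-identityˡ (- x)) (0≤y-x x≤0)

  0<1 : 0# < 1#
  0<1 = ≤-respʳ (*-identityˡ 1#) (0≤x*x 1#) , 0≉1

  x*y≈0⇒y≈0 : ∀ {x y} → ¬ (x ≈ 0#) → x * y ≈ 0# → y ≈ 0#
  x*y≈0⇒y≈0 {x} {y} x≉0 xy≈0 with inverse x x≉0
  ... | x⁻¹ , xx⁻¹≈1 = begin
    y              ≈⟨ *-identityˡ y ⟨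
    1# * y         ≈⟨ *-congʳ xx⁻¹≈1 ⟨
    (x * x⁻¹) * y  ≈⟨ solve 3 (λ x i y → x :* i :* y := i :* (x :* y)) refl x x⁻¹ y ⟩
    x⁻¹ * (x * y)  ≈⟨ *-congˡ xy≈0 ⟩
    x⁻¹ * 0#       ≈⟨ zeroʳ x⁻¹ ⟩
    0#             ∎
    where open SetoidReasoning setoid

  *-pos : ∀ {x y} → 0# < x → 0# < y → 0# < x * y
  *-pos (0≤x , 0≉x) (0≤y , 0≉y) = *-nonNeg 0≤x 0≤y , λ 0≈xy →
    0≉y (sym (x*y≈0⇒y≈0 (λ x≈0 → 0≉x (sym x≈0)) (sym 0≈xy)))

  *-cancelˡ-≤ : ∀ {t x y} → 0# < t → t * x ≤ t * y → x ≤ y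
  *-cancelˡ-≤ {t} {x} {y} 0<t tx≤ty with ≤-or-< x y
  ... | inj₁ x≤y = x≤y
  ... | inj₂ (y≤x , y≉x) = ≤-reflexive (x∙y⁻¹≈ε⇒x≈y x y (x*y≈0⇒y≈0 (λ t≈0 → proj₂ 0<t (sym t≈0)) tx-ty≈0))
    where
    tx-ty≈0 : t * (x - y) ≈ 0#
    tx-ty≈0 = trans (solve 3 (λ t x y → t :* (x :- y) := t :* x :- t :* y) refl t x y)
      (x≈y⇒x∙y⁻¹≈ε (antisym tx≤ty (*-monoˡ-≤ (proj₁ 0<t) y≤x)))

  inverse-pos : ∀ {x} → 0# < x → ∃[ y ] 0# < y × x * y ≈ 1#
  inverse-pos {x} 0<x with inverse x (λ x≈0 → proj₂ 0<x (sym x≈0))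
  ... | y , xy≈1 = y , ≱⇒< y≰0 , xy≈1
    where
    y≰0 : ¬ y ≤ 0#
    y≰0 y≤0 = <⇒≱ 0<1 (≤-respʳ (zeroʳ x) (≤-respˡ xy≈1 (*-monoˡ-≤ (proj₁ 0<x) y≤0)))

  -- Truth for all sufficiently small positive parameters. Finitely many such properties can be met
  -- by one parameter, which replaces explicit choices of step lengths and radii.
  Eventually : (Carrier → Set) → Set
  Eventually P = ∃[ η ] 0# < η × (∀ t → 0# < t → t ≤ η → P t)

  eventually-map : ∀ {P Q : Carrier → Set} → (∀ {t} → 0# < t → P t → Q t) → Eventually P → Eventually Q
  eventually-map f (η , 0<η , p) = η , 0<η , λ t 0<t t≤η → f 0<t (p t 0<t t≤η)

  eventually-× : ∀ {P Q : Carrier → Set} → Eventually P → Eventually Q → Eventually (λ t → P t × Q t)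
  eventually-× (η , 0<η , p) (δ , 0<δ , q) with total η δ
  ... | inj₁ η≤δ = η , 0<η , λ t 0<t t≤η → p t 0<t t≤η , q t 0<t (≤-trans t≤η η≤δ)
  ... | inj₂ δ≤η = δ , 0<δ , λ t 0<t t≤δ → p t 0<t (≤-trans t≤δ δ≤η) , q t 0<t t≤δ

  eventually-∀ : ∀ {k} {P : Fin k → Carrier → Set} →
                 (∀ i → Eventually (P i)) → Eventually (λ t → ∀ i → P i t)
  eventually-∀ {zero}  p = 1# , 0<1 , λ _ _ _ ()
  eventually-∀ {suc k} p = eventually-map (λ _ (p₀ , pₛ) → λ { zero → p₀ ; (suc i) → pₛ i })
    (eventually-× (p zero) (eventually-∀ (λ i → p (suc i))))

  eventually⇒∃ : ∀ {P : Carrier → Set} → Eventually P → ∃[ t ] 0# < t × P t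
  eventually⇒∃ (η , 0<η , p) = η , 0<η , p η 0<η ≤-refl

  eventually-≤ : ∀ {r} → 0# < r → Eventually (λ t → t ≤ r)
  eventually-≤ {r} 0<r = r , 0<r , λ _ _ t≤r → t≤r

  x<x+y : ∀ {x y} → 0# < y → x < x + y
  x<x+y {x} {y} (0≤y , 0≉y) =
    ≤-from y 0≤y (solve 2 (λ x y → y := x :+ y :- x) refl x y) ,
    λ x≈x+y → 0≉y (trans (sym (x≈y⇒x∙y⁻¹≈ε (sym x≈x+y))) (solve 2 (λ x y → x :+ y :- x := y) refl x y))

  eventually-small : ∀ c {δ} → 0# < δ → Eventually (λ t → t * c < δ)
  eventually-small c {δ} 0<δ = helper (total c 0#)
    where
    helper : c ≤ 0# ⊎ 0# ≤ c → Eventually (λ t → t * c < δ)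
    helper (inj₁ c≤0) = 1# , 0<1 , λ t 0<t _ →
      ≤-<-trans (≤-respʳ (zeroʳ t) (*-monoˡ-≤ (proj₁ 0<t) c≤0)) 0<δ
    helper (inj₂ 0≤c) = bound (inverse-pos 0<c+1)
      where
      0<c+1 : 0# < c + 1#
      0<c+1 = ≤-<-trans 0≤c (x<x+y 0<1)
      bound : (∃[ i ] 0# < i × (c + 1#) * i ≈ 1#) → Eventually (λ t → t * c < δ)
      -- The threshold is `δ / (c + 1)`: dividing by `c + 1` covers `c = 0` and makes the bound
      -- strict, since `t * c < t * c + t ≤ δ`.
      bound (i , 0<i , [c+1]i≈1) = δ * i , *-pos 0<δ 0<i , λ t 0<t t≤δi →
        <-≤-trans (x<x+y 0<t)
          (≤-respˡ ([c+1]t≈tc+t t) (≤-respʳ [c+1]δi≈δ (*-monoˡ-≤ (proj₁ 0<c+1) t≤δi)))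
        where
        [c+1]t≈tc+t : ∀ t → (c + 1#) * t ≈ t * c + t
        [c+1]t≈tc+t t = trans (solve 3 (λ t c o → (c :+ o) :* t := t :* c :+ o :* t) refl t c 1#)
          (+-congˡ (*-identityˡ t))
        [c+1]δi≈δ : (c + 1#) * (δ * i) ≈ δ
        [c+1]δi≈δ = trans (solve 3 (λ d i e → e :* (d :* i) := d :* (e :* i)) refl δ i (c + 1#))
          (trans (*-congˡ [c+1]i≈1) (*-identityʳ δ))

  argmax : ∀ {k} (P : Fin k → Set) (f : Fin k → Carrier) → ∃ P →
           ∃[ i ] P i × (∀ j → P j → f j ≤ f i)
  argmax {suc k} P f ∃P with em {∃[ i ] P (suc i)} | em {P zero}
  argmax {suc k} P f (zero  , p₀) | _ | no ¬p₀ = ⊥-elim (¬p₀ p₀)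
  argmax {suc k} P f (suc i , pᵢ) | no ¬p | _  = ⊥-elim (¬p (i , pᵢ))
  argmax {suc k} P f ∃P | no ¬p | yes p₀ = zero , p₀ ,
    λ { zero _ → ≤-refl ; (suc j) pⱼ → ⊥-elim (¬p (j , pⱼ)) }
  argmax {suc k} P f ∃P | yes p | d with argmax (λ i → P (suc i)) (λ i → f (suc i)) p
  ... | i , pᵢ , max with d | total (f zero) (f (suc i))
  ... | no ¬p₀ | _ = suc i , pᵢ , λ { zero p₀ → ⊥-elim (¬p₀ p₀) ; (suc j) → max j }
  ... | yes _ | inj₁ f₀≤fᵢ = suc i , pᵢ , λ { zero _ → f₀≤fᵢ ; (suc j) → max j }
  ... | yes p₀ | inj₂ fᵢ≤f₀ = zero , p₀ ,
    λ { zero _ → ≤-refl ; (suc j) pⱼ → ≤-trans (max j pⱼ) fᵢ≤f₀ }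

-- Classical subsets and minimisation.

module Classical (em : ExcludedMiddle 0ℓ) where

  -- Deciding a predicate classically makes it usable as a conditioning set of a CI statement and
  -- gives it a cardinality.
  toSubset : ∀ {n} → Pred (Fin n) 0ℓ → Subset n
  toSubset P = tabulate (λ i → does (em {P i}))

  ∈-toSubset⁺ : ∀ {n} {P : Pred (Fin n) 0ℓ} {i} → P i → i ∈ˢ toSubset P
  ∈-toSubset⁺ {P = P} {i} pᵢ = lookup⇒[]= i _ (≡.trans (lookup∘tabulate _ i) (dec-true em pᵢ))

  ∈-toSubset⁻ : ∀ {n} {P : Pred (Fin n) 0ℓ} {i} → i ∈ˢ toSubset P → P i
  ∈-toSubset⁻ {P = P} {i} i∈
    with em {P i} | ≡.trans (≡.sym (lookup∘tabulate (λ i → does (em {P i})) i)) ([]=⇒lookup i∈)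
  ... | yes pᵢ | _ = pᵢ

  minimiser : ∀ {A : Set} (S : Pred A 0ℓ) (μ : A → ℕ) → Satisfiable S →
              ∃[ x ] S x × (∀ y → S y → μ x ℕ.≤ μ y)
  minimiser S μ (x , x∈S) = descend (μ x) x x∈S ℕ.≤-refl
    where
    -- The bound `n` on the current value is what decreases structurally.
    descend : ∀ n x → S x → μ x ℕ.≤ n → ∃[ x ] S x × (∀ y → S y → μ x ℕ.≤ μ y)
    descend n x x∈S μx≤n with em {∃[ y ] S y × μ y ℕ.< μ x}
    descend n x x∈S μx≤n | no ∄y = x , x∈S , λ y y∈S → ℕ.≮⇒≥ λ μy<μx → ∄y (y , y∈S , μy<μx)
    descend zero x x∈S μx≤0 | yes (y , y∈S , μy<μx) = ⊥-elim (ℕ.n≮0 (ℕ.<-≤-trans μy<μx μx≤0))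
    descend (suc n) x x∈S μx≤n | yes (y , y∈S , μy<μx) =
      descend n y y∈S (ℕ.≤-pred (ℕ.<-≤-trans μy<μx μx≤n))

-- Linear functionals, affine hulls and balls in Euclidean space.

module Points (em : ExcludedMiddle 0ℓ) (ℝ : RealNumbers) (m : ℕ) where
  open RealNumbers ℝ hiding (zero)
  open OrderedField em ℝ
  open Solver using (solve; _:=_; _:+_; _:*_; _:-_; :-_)
  open Polyhedral ℝ m
  open SemiringSum semiring using (sum; sum-cong-≋; ∑-distrib-+; ∑-comm; *-distribˡ-sum; sum-replicate-zero)
  open RingProperties ring using (-1*x≈-x)
  open SetoidReasoning setoid

  infixl 6 _+[_]_

  _+[_]_ : Point → Carrier → Point → Point
  (x +[ t ] w) e = x e + t * w e

  0ᵖ : Point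
  0ᵖ _ = 0#

  ·-comm : ∀ a x → a · x ≈ x · a
  ·-comm a x = sum-cong-≋ (λ e → *-comm (a e) (x e))

  ·-congˡ : ∀ {a x y} → (∀ e → x e ≈ y e) → a · x ≈ a · y
  ·-congˡ x≋y = sum-cong-≋ (λ e → *-congˡ (x≋y e))

  ·-linearʳ : ∀ a x t w → a · (x +[ t ] w) ≈ a · x + t * (a · w)
  ·-linearʳ a x t w = begin
    sum (λ e → a e * (x e + t * w e))
      ≈⟨ sum-cong-≋ (λ e → solve 4 (λ a x t w → a :* (x :+ t :* w) := a :* x :+ t :* (a :* w))
                             refl (a e) (x e) t (w e)) ⟩
    sum (λ e → a e * x e + t * (a e * w e))
      ≈⟨ ∑-distrib-+ (λ e → a e * x e) (λ e → t * (a e * w e)) ⟩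
    a · x + sum (λ e → t * (a e * w e))
      ≈⟨ +-congˡ (*-distribˡ-sum t (λ e → a e * w e)) ⟨
    a · x + t * (a · w) ∎

  ·-linearˡ : ∀ a t b x → (a +[ t ] b) · x ≈ a · x + t * (b · x)
  ·-linearˡ a t b x = begin
    (a +[ t ] b) · x       ≈⟨ ·-comm (a +[ t ] b) x ⟩
    x · (a +[ t ] b)       ≈⟨ ·-linearʳ x a t b ⟩
    x · a + t * (x · b)    ≈⟨ +-cong (·-comm x a) (*-congˡ (·-comm x b)) ⟩
    a · x + t * (b · x)    ∎

  ·-zeroˡ : ∀ x → 0ᵖ · x ≈ 0#
  ·-zeroˡ x = trans (sum-cong-≋ (λ e → zeroˡ (x e))) (sum-replicate-zero m)

  ·-zeroʳ : ∀ a → a · 0ᵖ ≈ 0#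
  ·-zeroʳ a = trans (·-comm a 0ᵖ) (·-zeroˡ a)

  _⊖_ : Point → Point → Point
  a ⊖ b = a +[ - 1# ] b

  ⊖-· : ∀ a b x → (a ⊖ b) · x ≈ a · x - b · x
  ⊖-· a b x = trans (·-linearˡ a (- 1#) b x) (+-congˡ (-1*x≈-x (b · x)))

  ·-⊖ : ∀ a x y → a · (x ⊖ y) ≈ a · x - a · y
  ·-⊖ a x y = trans (·-linearʳ a x (- 1#) y) (+-congˡ (-1*x≈-x (a · y)))

  sum-nonNeg : ∀ {k} {f : Vector Carrier k} → (∀ i → 0# ≤ f i) → 0# ≤ sum f
  sum-nonNeg {zero}  0≤f = ≤-refl
  sum-nonNeg {suc k} 0≤f = +-nonNeg (0≤f zero) (sum-nonNeg (λ i → 0≤f (suc i)))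

  0≤x·x : ∀ x → 0# ≤ x · x
  0≤x·x x = sum-nonNeg (λ e → 0≤x*x (x e))

  ·-combination : ∀ a {k} (c : Vector Carrier k) (p : Vector Point k) →
                  a · (λ e → sum (λ i → c i * p i e)) ≈ sum (λ i → c i * (a · p i))
  ·-combination a c p = begin
    sum (λ e → a e * sum (λ i → c i * p i e))
      ≈⟨ sum-cong-≋ (λ e → *-distribˡ-sum (a e) (λ i → c i * p i e)) ⟩
    sum (λ e → sum (λ i → a e * (c i * p i e)))
      ≈⟨ sum-cong-≋ (λ e → sum-cong-≋ (λ i →
           solve 3 (λ a c p → a :* (c :* p) := c :* (a :* p)) refl (a e) (c i) (p i e))) ⟩
    sum (λ e → sum (λ i → c i * (a e * p i e)))
      ≈⟨ ∑-comm (λ e i → c i * (a e * p i e)) ⟩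
    sum (λ i → sum (λ e → c i * (a e * p i e)))
      ≈⟨ sum-cong-≋ (λ i → *-distribˡ-sum (c i) (λ e → a e * p i e)) ⟨
    sum (λ i → c i * (a · p i)) ∎

  -- Lets ties between path weights that hold on a whole cone persist on its affine hull, where
  -- relative interiors are tested.
  affineHull-≈0 : ∀ {S} a → (∀ p → p ∈ S → a · p ≈ 0#) → ∀ y → y ∈ affineHull S → a · y ≈ 0#
  affineHull-≈0 a a≈0 y (k , c , p , p∈S , _ , y≈) = begin
    a · y                                ≈⟨ ·-congˡ y≈ ⟩
    a · (λ e → sum (λ i → c i * p i e))  ≈⟨ ·-combination a c p ⟩
    sum (λ i → c i * (a · p i))          ≈⟨ sum-cong-≋ (λ i → trans (*-congˡ (a≈0 (p i) (p∈S i))) (zeroʳ (c i))) ⟩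
    sum {k} (λ _ → 0#)                   ≈⟨ sum-replicate-zero k ⟩
    0#                                   ∎

  -- The point is the affine combination `(1 + t) x - t y`; it prolongs the segment from `y` to `x`
  -- beyond `x` and serves as a test point for relative interiors.
  affineHull-line : ∀ {S x y} → x ∈ S → y ∈ S → ∀ t → (x +[ t ] (x ⊖ y)) ∈ affineHull S
  affineHull-line {S} {x} {y} x∈S y∈S t = 2 , c , p , p∈S , sum-c , eq
    where
    c : Vector Carrier 2
    c zero       = 1# + t
    c (suc zero) = - t
    p : Vector Point 2
    p zero       = x
    p (suc zero) = y
    p∈S : ∀ i → p i ∈ S
    p∈S zero       = x∈S
    p∈S (suc zero) = y∈S
    sum-c : (1# + t) + (- t + 0#) ≈ 1#
    sum-c = trans (+-congˡ (+-identityʳ (- t))) (solve 2 (λ o t → (o :+ t) :+ (:- t) := o) refl 1# t)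
    eq : ∀ e → x e + t * (x e + - 1# * y e) ≈ (1# + t) * x e + (- t * y e + 0#)
    eq e = begin
      x e + t * (x e + - 1# * y e)
        ≈⟨ +-cong (sym (*-identityˡ (x e))) (*-congˡ (+-congˡ (-1*x≈-x (y e)))) ⟩
      1# * x e + t * (x e - y e)
        ≈⟨ solve 4 (λ t x o y → o :* x :+ t :* (x :- y) := (o :+ t) :* x :+ (:- t) :* y) refl t (x e) 1# (y e) ⟩
      (1# + t) * x e + - t * y e
        ≈⟨ +-congˡ (+-identityʳ _) ⟨
      (1# + t) * x e + (- t * y e + 0#) ∎

  -- The squared distance is `t²‖w‖²`, which for `t ≤ 1` is at most `t‖w‖²`, so a bound linear in
  -- `t` suffices.
  near-shift : ∀ x w {r} → 0# < r → Eventually (λ t → Near r x (x +[ t ] w))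
  near-shift x w {r} 0<r = eventually-map near
    (eventually-× (eventually-≤ 0<1) (eventually-small (w · w) (*-pos 0<r 0<r)))
    where
    near : ∀ {t} → 0# < t → t ≤ 1# × t * (w · w) < r * r → Near r x (x +[ t ] w)
    near {t} 0<t (t≤1 , tw²<r²) = ≤-<-trans (≤-respˡ (sym norm) t²w²≤tw²) tw²<r²
      where
      norm : sum (λ e → (x e - (x e + t * w e)) * (x e - (x e + t * w e))) ≈ t * (t * (w · w))
      norm = begin
        sum (λ e → (x e - (x e + t * w e)) * (x e - (x e + t * w e)))
          ≈⟨ sum-cong-≋ (λ e → solve 3
               (λ x t w → (x :- (x :+ t :* w)) :* (x :- (x :+ t :* w)) := t :* (t :* (w :* w)))
               refl (x e) t (w e)) ⟩
        sum (λ e → t * (t * (w e * w e)))   ≈⟨ *-distribˡ-sum t (λ e → t * (w e * w e)) ⟨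
        t * sum (λ e → t * (w e * w e))     ≈⟨ *-congˡ (*-distribˡ-sum t (λ e → w e * w e)) ⟨
        t * (t * (w · w))                   ∎
      t²w²≤tw² : t * (t * (w · w)) ≤ t * (w · w)
      t²w²≤tw² = ≤-respʳ (trans (*-comm _ 1#) (*-identityˡ _))
        (≤-respˡ (*-comm _ t) (*-monoˡ-≤ (*-nonNeg (proj₁ 0<t) (0≤x·x w)) t≤1))

  -- From 0 ≤ ‖z − s a‖² with z = x − y one gets 2s(a · z) ≤ ‖z‖² + s²‖a‖²; choosing s with
  -- s‖a‖² < a · x bounds ‖z‖² away from 0 as soon as a · y ≤ 0.
  near-halfspace : ∀ a x → 0# < a · x → Eventually (λ r → ∀ y → Near r x y → 0# < a · y)
  near-halfspace a x 0<ax = halfspace (eventually⇒∃ (eventually-small (a · a) 0<ax))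
    where
    δ = a · x
    halfspace : (∃[ s ] 0# < s × s * (a · a) < δ) → Eventually (λ r → ∀ y → Near r x y → 0# < a · y)
    -- Radii at most 1 and at most `s * δ` satisfy `r² ≤ s * δ`, which contradicts `‖z‖² < r²` once
    -- `s * δ ≤ ‖z‖²`.
    halfspace (s , 0<s , sa²<δ) = eventually-map positive
      (eventually-× (eventually-≤ 0<1) (eventually-≤ (*-pos 0<s 0<ax)))
      where
      positive : ∀ {r} → 0# < r → r ≤ 1# × r ≤ s * δ → ∀ y → Near r x y → 0# < a · y
      positive {r} 0<r (r≤1 , r≤sδ) y near = ≱⇒< λ ay≤0 → <⇒≱ near (≤-trans r²≤sδ (sδ≤z² ay≤0))
        where
        z : Point
        z e = x e - y e
        r²≤sδ : r * r ≤ s * δ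
        r²≤sδ = ≤-trans (≤-respʳ (trans (*-comm r 1#) (*-identityˡ r)) (*-monoˡ-≤ (proj₁ 0<r) r≤1)) r≤sδ
        az≈ : a · z ≈ δ - a · y
        az≈ = begin
          a · z        ≈⟨ ·-congˡ (λ e → +-congˡ (sym (-1*x≈-x (y e)))) ⟩
          a · (x ⊖ y)  ≈⟨ ·-⊖ a x y ⟩
          δ - a · y    ∎
        square : (z +[ - s ] a) · (z +[ - s ] a) ≈ (z · z + - s * (a · z)) + - s * (a · z + - s * (a · a))
        square = begin
          (z +[ - s ] a) · (z +[ - s ] a)
            ≈⟨ ·-linearʳ (z +[ - s ] a) z (- s) a ⟩
          (z +[ - s ] a) · z + - s * ((z +[ - s ] a) · a)
            ≈⟨ +-cong (·-linearˡ z (- s) a z) (*-congˡ (·-linearˡ z (- s) a a)) ⟩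
          (z · z + - s * (a · z)) + - s * (z · a + - s * (a · a))
            ≈⟨ +-congˡ (*-congˡ (+-congʳ (·-comm z a))) ⟩
          (z · z + - s * (a · z)) + - s * (a · z + - s * (a · a)) ∎
        sδ≤z² : a · y ≤ 0# → s * δ ≤ z · z
        -- The nonnegative terms `‖z - s a‖²`, `s (δ - s‖a‖²)` and twice `s (a · z - δ)` add up to
        -- `‖z‖² - s δ`.
        sδ≤z² ay≤0 = ≤-from _
          (+-nonNeg (0≤x·x (z +[ - s ] a))
            (+-nonNeg (*-nonNeg (proj₁ 0<s) (0≤y-x (proj₁ sa²<δ)))
              (+-nonNeg (*-nonNeg (proj₁ 0<s) 0≤az-δ) (*-nonNeg (proj₁ 0<s) 0≤az-δ))))
          (trans (+-congʳ square)
            (solve 5 (λ zz s az aa d →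
              (zz :+ (:- s) :* az) :+ (:- s) :* (az :+ (:- s) :* aa) :+
              (s :* (d :- s :* aa) :+ (s :* (az :- d) :+ s :* (az :- d))) := zz :- s :* d)
              refl (z · z) s (a · z) (a · a) δ))
          where
          0≤az-δ : 0# ≤ a · z - δ
          0≤az-δ = ≤-respʳ
            (trans (solve 2 (λ d y → (:- y) := (d :- y) :- d) refl δ (a · y)) (+-congʳ (sym az≈)))
            (≤-respʳ (+-identityˡ (- (a · y))) (0≤y-x ay≤0))

-- Faces cut out by several functionals at once.

module Faces (em : ExcludedMiddle 0ℓ) (ℝ : RealNumbers) (m : ℕ) where
  open RealNumbers ℝ hiding (zero)
  open OrderedField em ℝ
  open Solver using (solve; _:=_; _:+_; _:*_; _:-_; :-_)
  open Polyhedral ℝ m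
  open Points em ℝ m

  IsFaceOf-resp : ∀ {F F′ P P′} → F ≐ F′ → P ≐ P′ → IsFaceOf F P → IsFaceOf F′ P′
  IsFaceOf-resp (F⊆F′ , F′⊆F) (P⊆P′ , P′⊆P) (a , b , valid , F⊆ , ⊆F) =
    a , b , (λ x x∈P′ → valid x (P′⊆P x∈P′)) ,
    (λ x∈F′ → let x∈P , ax≈b = F⊆ (F′⊆F x∈F′) in P⊆P′ x∈P , ax≈b) ,
    (λ (x∈P′ , ax≈b) → F⊆F′ (⊆F (P′⊆P x∈P′ , ax≈b)))

  IsPolyhedralCone-resp : ∀ {P P′} → P ≐ P′ → IsPolyhedralCone P → IsPolyhedralCone P′
  IsPolyhedralCone-resp (P⊆P′ , P′⊆P) (k , a , P⊆ , ⊆P) = k , a , P⊆ ∘ P′⊆P , P⊆P′ ∘ ⊆P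

  nonNeg-+≈0 : ∀ {x y} → 0# ≤ x → 0# ≤ y → x + y ≈ 0# → x ≈ 0# × y ≈ 0#
  nonNeg-+≈0 {x} {y} 0≤x 0≤y x+y≈0 =
    antisym (≤-from y 0≤y (y≈0-x x y x+y≈0)) 0≤x ,
    antisym (≤-from x 0≤x (y≈0-x y x (trans (+-comm y x) x+y≈0))) 0≤y
    where
    y≈0-x : ∀ x y → x + y ≈ 0# → y ≈ 0# - x
    y≈0-x x y x+y≈0 = trans (solve 2 (λ x y → y := x :+ y :- x) refl x y) (+-congʳ x+y≈0)

  -- The sum of the functionals vanishes exactly on their common zero set.
  zeros-isFace : ∀ {k} P (a : Vector Point k) → (∀ i x → x ∈ P → 0# ≤ a i · x) →
                 IsFaceOf (λ x → x ∈ P × (∀ i → a i · x ≈ 0#)) P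
  zeros-isFace P a 0≤a with total-functional a 0≤a
    where
    total-functional : ∀ {k} (a : Vector Point k) → (∀ i x → x ∈ P → 0# ≤ a i · x) →
      ∃[ s ] (∀ x → x ∈ P → 0# ≤ s · x) ×
             (∀ x → x ∈ P → s · x ≈ 0# → ∀ i → a i · x ≈ 0#) ×
             (∀ x → (∀ i → a i · x ≈ 0#) → s · x ≈ 0#)
    total-functional {zero} a 0≤a =
      0ᵖ , (λ x _ → ≤-reflexive (sym (·-zeroˡ x))) , (λ _ _ _ ()) , λ x _ → ·-zeroˡ x
    total-functional {suc k} a 0≤a with total-functional (a ∘ suc) (0≤a ∘ suc)
    ... | s , 0≤s , s≈0⇒ , ⇒s≈0 = a zero +[ 1# ] s ,
      (λ x x∈P → ≤-respʳ (sym (eq x)) (+-nonNeg (0≤a zero x x∈P) (0≤s x x∈P))) ,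
      (λ x x∈P sx≈0 → let a₀≈0 , s≈0 = nonNeg-+≈0 (0≤a zero x x∈P) (0≤s x x∈P) (trans (sym (eq x)) sx≈0)
                      in λ { zero → a₀≈0 ; (suc i) → s≈0⇒ x x∈P s≈0 i }) ,
      (λ x a≈0 → trans (eq x) (trans (+-cong (a≈0 zero) (⇒s≈0 x (a≈0 ∘ suc))) (+-identityʳ 0#)))
      where
      eq : ∀ x → (a zero +[ 1# ] s) · x ≈ a zero · x + s · x
      eq x = trans (·-linearˡ (a zero) 1# s x) (+-congˡ (*-identityˡ (s · x)))
  ... | s , 0≤s , s≈0⇒ , ⇒s≈0 = s , 0# , 0≤s ,
    (λ {x} (x∈P , a≈0) → x∈P , ⇒s≈0 x a≈0) ,
    (λ {x} (x∈P , s≈0) → x∈P , s≈0⇒ x x∈P s≈0)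

-- The fan of cells: critical indices, faces, closures and relative interiors.

-- Paths are abstracted to a finite index set Q, endpoints to cls, and indicator vectors of paths to χ.
module Cells (em : ExcludedMiddle 0ℓ) (ℝ : RealNumbers) (m : ℕ) {Q K : Set} {N : ℕ}
             (enum : Fin N → Q) (index-of : Q → Fin N) (enum-index : ∀ q → enum (index-of q) ≡ q)
             (cls : Q → K) (χ : Q → Polyhedral.Point ℝ m)
             (separated : ∀ q q′ → q ≢ q′ → cls q ≡ cls q′ →
                          ∃[ w ] ¬ RealNumbers._≈_ ℝ (Polyhedral._·_ ℝ m (χ q) w) (Polyhedral._·_ ℝ m (χ q′) w))
             where
  open RealNumbers ℝ hiding (zero)
  open OrderedField em ℝ
  open Solver using (solve; _:=_; _:+_; _:*_; _:-_; :-_)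
  open Classical em
  open Polyhedral ℝ m
  open Points em ℝ m
  open Faces em ℝ m
  open RingProperties ring using (x∙y⁻¹≈ε⇒x≈y; x≈y⇒x∙y⁻¹≈ε)

  record Crit (x : Point) (q : Q) : Set where
    constructor isMax
    field maximum : ∀ q′ → cls q′ ≡ cls q → χ q′ · x ≤ χ q · x
  open Crit

  Cell : Point → Pred Point 0ℓ
  Cell x y = Crit x ⊆ Crit y

  -- The abstract counterpart of genericity.
  UniqueCrit : Pred Point 0ℓ
  UniqueCrit x = ∀ q q′ → cls q ≡ cls q′ → Crit x q → Crit x q′ → q ≡ q′

  crit-exists : ∀ x q → ∃[ q₀ ] cls q₀ ≡ cls q × Crit x q₀
  crit-exists x q with argmax (λ k → cls (enum k) ≡ cls q) (λ k → χ (enum k) · x)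
                              (index-of q , ≡.cong cls (enum-index q))
  ... | k , same , max = enum k , same , isMax λ q′ same′ →
    ≡.subst (λ p → χ p · x ≤ χ (enum k) · x) (enum-index q′)
      (max (index-of q′) (≡.trans (≡.cong cls (enum-index q′)) (≡.trans same′ same)))

  crit-≥ : ∀ {x q₀ q} → cls q₀ ≡ cls q → Crit x q₀ → χ q₀ · x ≤ χ q · x → Crit x q
  crit-≥ same crit₀ q₀≤q = isMax λ q′ same′ → ≤-trans (maximum crit₀ q′ (≡.trans same′ (≡.sym same))) q₀≤q

  crit-≈ : ∀ {x q q′} → cls q ≡ cls q′ → Crit x q → Crit x q′ → χ q · x ≈ χ q′ · x
  crit-≈ same crit crit′ = antisym (maximum crit′ _ same) (maximum crit _ (≡.sym same))

  crit-< : ∀ {x q₀ q} → cls q₀ ≡ cls q → Crit x q₀ → ¬ Crit x q → χ q · x < χ q₀ · x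
  crit-< same crit₀ ¬crit = ≱⇒< λ q₀≤q → ¬crit (crit-≥ same crit₀ q₀≤q)

  crit-0 : ∀ q → Crit 0ᵖ q
  crit-0 q = isMax λ q′ _ → ≤-reflexive (trans (·-zeroʳ (χ q′)) (sym (·-zeroʳ (χ q))))

  crit-+ : ∀ {x t w q} → 0# ≤ t → Crit x q → Crit w q → Crit (x +[ t ] w) q
  crit-+ {x} {t} {w} {q} 0≤t crit-x crit-w = isMax λ q′ same →
    ≤-respˡ (sym (·-linearʳ (χ q′) x t w)) (≤-respʳ (sym (·-linearʳ (χ q) x t w))
      (+-mono-≤ (maximum crit-x q′ same) (*-monoˡ-≤ 0≤t (maximum crit-w q′ same))))

  -- Since `q₀` is maximal for both summands, `q` can tie with it on the sum only by tying with it
  -- on each.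
  crit-+⁻ : ∀ {x t w q₀ q} → 0# < t → cls q₀ ≡ cls q → Crit x q₀ → Crit w q₀ →
            Crit (x +[ t ] w) q → Crit x q × Crit w q
  crit-+⁻ {x} {t} {w} {q₀} {q} 0<t same x₀ w₀ crit =
    crit-≥ same x₀ (≤-from _ (+-nonNeg gap (*-nonNeg (proj₁ 0<t) (0≤y-x w-le)))
      (solve 5 (λ a b c d t → (c :+ t :* d) :- (a :+ t :* b) :+ t :* (b :- d) := c :- a)
        refl (χ q₀ · x) (χ q₀ · w) (χ q · x) (χ q · w) t)) ,
    crit-≥ same w₀ (*-cancelˡ-≤ 0<t (≤-from _ (+-nonNeg gap (0≤y-x x-le))
      (solve 5 (λ a b c d t → (c :+ t :* d) :- (a :+ t :* b) :+ (a :- c) := t :* d :- t :* b)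
        refl (χ q₀ · x) (χ q₀ · w) (χ q · x) (χ q · w) t)))
    where
    x-le : χ q · x ≤ χ q₀ · x
    x-le = maximum x₀ q (≡.sym same)
    w-le : χ q · w ≤ χ q₀ · w
    w-le = maximum w₀ q (≡.sym same)
    gap : 0# ≤ (χ q · x + t * (χ q · w)) - (χ q₀ · x + t * (χ q₀ · w))
    gap = 0≤y-x (≤-respˡ (·-linearʳ (χ q₀) x t w) (≤-respʳ (·-linearʳ (χ q) x t w) (maximum crit q₀ same)))

  eventually-∀q : ∀ {P : Q → Carrier → Set} → (∀ q → Eventually (P q)) → Eventually (λ t → ∀ q → P q t)
  eventually-∀q {P} p = eventually-map
    (λ {t} _ p q → ≡.subst (λ q → P q t) (enum-index q) (p (index-of q)))
    (eventually-∀ (λ k → p (enum k)))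

  -- A non-critical index falls short of a critical one by a positive gap, which a short enough step
  -- along `w` cannot close; there are finitely many indices.
  eventually-⊆ : ∀ x w → Eventually (λ t → Crit (x +[ t ] w) ⊆ Crit x)
  eventually-⊆ x w = eventually-map (λ _ p {q} → p q) (eventually-∀q single)
    where
    single : ∀ q → Eventually (λ t → Crit (x +[ t ] w) q → Crit x q)
    single q with em {Crit x q}
    ... | yes crit = 1# , 0<1 , λ _ _ _ _ → crit
    ... | no ¬crit with crit-exists x q
    ... | q₀ , same , crit₀ = eventually-map absurd
          (eventually-small (χ q · w - χ q₀ · w) (0<y-x (crit-< same crit₀ ¬crit)))
      where
      absurd : ∀ {t} → 0# < t → t * (χ q · w - χ q₀ · w) < χ q₀ · x - χ q · x →
               Crit (x +[ t ] w) q → Crit x q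
      absurd {t} _ small crit = ⊥-elim (<⇒≱ small (≤-from _
        (0≤y-x (≤-respˡ (·-linearʳ (χ q₀) x t w) (≤-respʳ (·-linearʳ (χ q) x t w) (maximum crit q₀ same))))
        (solve 5 (λ a b c d t → (c :+ t :* d) :- (a :+ t :* b) := t :* (d :- b) :- (a :- c))
          refl (χ q₀ · x) (χ q₀ · w) (χ q · x) (χ q · w) t)))

  -- The same semicontinuity for balls: the open half-space on which a critical `q₀` beats a
  -- non-critical `q` contains a ball around `x`.
  eventually-near : ∀ x → Eventually (λ r → ∀ y → Near r x y → Crit y ⊆ Crit x)
  eventually-near x = eventually-map (λ _ p y near {q} → p q y near) (eventually-∀q single)
    where
    single : ∀ q → Eventually (λ r → ∀ y → Near r x y → Crit y q → Crit x q)
    single q with em {Crit x q}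
    ... | yes crit = 1# , 0<1 , λ _ _ _ _ _ _ → crit
    ... | no ¬crit with crit-exists x q
    ... | q₀ , same , crit₀ = eventually-map absurd
          (near-halfspace (χ q₀ ⊖ χ q) x
            (<-respʳ (sym (⊖-· (χ q₀) (χ q) x)) (0<y-x (crit-< same crit₀ ¬crit))))
      where
      absurd : ∀ {r} → 0# < r → (∀ y → Near r x y → 0# < (χ q₀ ⊖ χ q) · y) →
               ∀ y → Near r x y → Crit y q → Crit x q
      absurd _ pos y near crit = ⊥-elim (<⇒≱ (<-respʳ (⊖-· (χ q₀) (χ q) y) (pos y near))
        (≤-from _ (0≤y-x (maximum crit q₀ same))
          (trans (solve 2 (λ a b → b :- a := :- (a :- b)) refl (χ q₀ · y) (χ q · y)) (sym (+-identityˡ _)))))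

  -- Minimises the number of critical indices; a proper subset would have smaller cardinality.
  crit-minimal : ∀ {S : Pred Point 0ℓ} → Satisfiable S →
                 ∃[ x ] S x × (∀ y → S y → Crit y ⊆ Crit x → Crit x ⊆ Crit y)
  crit-minimal {S} sat with minimiser S (λ x → ∣ toSubset (Crit x ∘ enum) ∣) sat
  ... | x , x∈S , min = x , x∈S , minimal
    where
    minimal : ∀ y → S y → Crit y ⊆ Crit x → Crit x ⊆ Crit y
    minimal y y∈S y⊆x {q} crit-x with em {Crit y q}
    ... | yes crit-y = crit-y
    ... | no ¬crit-y = ⊥-elim (ℕ.<⇒≱ (p⊂q⇒∣p∣<∣q∣
            ( (λ k∈ → ∈-toSubset⁺ (y⊆x (∈-toSubset⁻ k∈)))
            , index-of q
            , ∈-toSubset⁺ (≡.subst (Crit x) (≡.sym (enum-index q)) crit-x)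
            , λ k∈ → ¬crit-y (≡.subst (Crit y) (enum-index q) (∈-toSubset⁻ k∈))))
          (min y y∈S))

  -- Were two indices of one class critical at the minimal `c`, a small step along a separating `w`
  -- would create no new critical index, hence by minimality lose none, and yet break the tie
  -- between these two.
  uniqueCrit-refinement : ∀ x → ∃[ c ] UniqueCrit c × x ∈ Cell c
  uniqueCrit-refinement x with crit-minimal {λ c → Crit c ⊆ Crit x} (x , λ p → p)
  ... | c , c⊆x , minimal = c , unique , c⊆x
    where
    unique : UniqueCrit c
    unique q q′ same crit crit′ with em {q ≡ q′}
    ... | yes q≡q′ = q≡q′
    ... | no q≢q′ with separated q q′ q≢q′ same
    ... | w , w-separates with eventually⇒∃ (eventually-⊆ c w)
    ... | t , 0<t , ⊆c = ⊥-elim (w-separates (x∙y⁻¹≈ε⇒x≈y _ _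
            (x*y≈0⇒y≈0 (λ t≈0 → proj₂ 0<t (sym t≈0)) t[q-q′]≈0)))
      where
      c⊆ : Crit c ⊆ Crit (c +[ t ] w)
      c⊆ = minimal (c +[ t ] w) (λ p → c⊆x (⊆c p)) ⊆c
      t[q-q′]≈0 : t * (χ q · w - χ q′ · w) ≈ 0#
      t[q-q′]≈0 = trans
        (solve 5 (λ a b c d t → t :* (b :- d) := ((a :+ t :* b) :- (c :+ t :* d)) :- (a :- c))
          refl (χ q · c) (χ q · w) (χ q′ · c) (χ q′ · w) t)
        (trans (+-cong
          (x≈y⇒x∙y⁻¹≈ε (trans (sym (·-linearʳ (χ q) c t w))
            (trans (crit-≈ same (c⊆ crit) (c⊆ crit′)) (·-linearʳ (χ q′) c t w))))
          (-‿cong (x≈y⇒x∙y⁻¹≈ε (crit-≈ same crit crit′))))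
          (-‿inverseʳ 0#))

  cell-isPolyhedral : ∀ x → IsPolyhedralCone (Cell x)
  cell-isPolyhedral x = N ℕ.* N , (λ i → functional (remQuot N i)) ,
    (λ {y} x⊆y i → nonNeg y x⊆y (remQuot N i)) , λ {y} 0≤a → inside y 0≤a
    where
    Active : Fin N × Fin N → Set
    Active (k , l) = Crit x (enum k) × cls (enum l) ≡ cls (enum k)
    -- Inactive pairs get the zero functional, whose inequality holds everywhere, so all `N * N`
    -- pairs can index the inequalities.
    functional : Fin N × Fin N → Point
    functional kl with em {Active kl}
    ... | yes _ = χ (enum (proj₁ kl)) ⊖ χ (enum (proj₂ kl))
    ... | no  _ = 0ᵖ
    nonNeg : ∀ y → Crit x ⊆ Crit y → ∀ kl → 0# ≤ functional kl · y
    nonNeg y x⊆y kl@(k , l) with em {Active kl}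
    ... | yes (crit , same) = ≤-respʳ (sym (⊖-· (χ (enum k)) (χ (enum l)) y))
                                (0≤y-x (maximum (x⊆y crit) (enum l) same))
    ... | no  _             = ≤-reflexive (sym (·-zeroˡ y))
    active : ∀ y kl → Active kl → 0# ≤ functional kl · y → χ (enum (proj₂ kl)) · y ≤ χ (enum (proj₁ kl)) · y
    active y kl@(k , l) act 0≤a with em {Active kl}
    ... | yes _   = ≤-from _ 0≤a (⊖-· (χ (enum k)) (χ (enum l)) y)
    ... | no ¬act = ⊥-elim (¬act act)
    inside : ∀ y → (∀ i → 0# ≤ functional (remQuot N i) · y) → Crit x ⊆ Crit y
    inside y 0≤a {q} crit = isMax λ q′ same →
      ≡.subst₂ (λ p p′ → χ p′ · y ≤ χ p · y) (enum-index q) (enum-index q′) (active y (index-of q , index-of q′)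
        (≡.subst (Crit x) (≡.sym (enum-index q)) crit ,
         ≡.trans (≡.cong cls (enum-index q′)) (≡.trans same (≡.sym (≡.cong cls (enum-index q)))))
        (≡.subst (λ kl → 0# ≤ functional kl · y) (remQuot-combine (index-of q) (index-of q′))
          (0≤a (combine (index-of q) (index-of q′)))))

  -- An index critical at `x` stays critical on the cell, so "best of the class minus `q`" is
  -- nonnegative there and vanishes exactly where `q` is critical. Imposing this for all `q` in `A`
  -- cuts out a face.
  subcell-isFace : ∀ x (A : Pred Q 0ℓ) → IsFaceOf (λ y → y ∈ Cell x × A ⊆ Crit y) (Cell x)
  subcell-isFace x A = IsFaceOf-resp
    {F = λ y → y ∈ Cell x × (∀ k → functional k · y ≈ 0#)}
    {F′ = λ y → y ∈ Cell x × A ⊆ Crit y} {P = Cell x}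
    ((λ {y} (x⊆y , a≈0) → (λ {q} → x⊆y {q}) , λ {q} → ⇒crit y x⊆y a≈0 {q}) ,
     (λ {y} (x⊆y , A⊆) → (λ {q} → x⊆y {q}) , λ k → crit⇒ y x⊆y A⊆ k))
    ≐-refl
    (zeros-isFace (Cell x) functional nonNeg)
    where
    best : Q → Q
    best q = proj₁ (crit-exists x q)
    best-cls : ∀ q → cls (best q) ≡ cls q
    best-cls q = proj₁ (proj₂ (crit-exists x q))
    best-crit : ∀ q → Crit x (best q)
    best-crit q = proj₂ (proj₂ (crit-exists x q))
    functional : Fin N → Point
    functional k with em {A (enum k)}
    ... | yes _ = χ (best (enum k)) ⊖ χ (enum k)
    ... | no  _ = 0ᵖ
    nonNeg : ∀ k y → y ∈ Cell x → 0# ≤ functional k · y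
    nonNeg k y x⊆y with em {A (enum k)}
    ... | yes _ = ≤-respʳ (sym (⊖-· (χ (best (enum k))) (χ (enum k)) y))
                    (0≤y-x (maximum (x⊆y (best-crit (enum k))) (enum k) (≡.sym (best-cls (enum k)))))
    ... | no  _ = ≤-reflexive (sym (·-zeroˡ y))
    crit⇒ : ∀ y → y ∈ Cell x → A ⊆ Crit y → ∀ k → functional k · y ≈ 0#
    crit⇒ y x⊆y A⊆ k with em {A (enum k)}
    ... | yes a = trans (⊖-· (χ (best (enum k))) (χ (enum k)) y)
                    (x≈y⇒x∙y⁻¹≈ε (crit-≈ (best-cls (enum k)) (x⊆y (best-crit (enum k))) (A⊆ a)))
    ... | no  _ = ·-zeroˡ y
    active : ∀ y → y ∈ Cell x → ∀ k → A (enum k) → functional k · y ≈ 0# → Crit y (enum k)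
    active y x⊆y k a a≈0 with em {A (enum k)}
    ... | no ¬a = ⊥-elim (¬a a)
    ... | yes _ = crit-≥ (best-cls (enum k)) (x⊆y (best-crit (enum k)))
                    (≤-reflexive (x∙y⁻¹≈ε⇒x≈y _ _ (trans (sym (⊖-· (χ (best (enum k))) (χ (enum k)) y)) a≈0)))
    ⇒crit : ∀ y → y ∈ Cell x → (∀ k → functional k · y ≈ 0#) → A ⊆ Crit y
    ⇒crit y x⊆y a≈0 {q} a = ≡.subst (Crit y) (enum-index q)
      (active y x⊆y (index-of q) (≡.subst A (≡.sym (enum-index q)) a) (a≈0 (index-of q)))

  ∩-isFace : ∀ x y → IsFaceOf (Cell x ∩ᴾ Cell y) (Cell x)
  ∩-isFace x y = subcell-isFace x (Crit y)

  -- When `y` lies in `Cell x`, the intersection of the two cells is `Cell y`.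
  cell-isFace : ∀ {x y} → Cell x y → IsFaceOf (Cell y) (Cell x)
  cell-isFace {x} {y} x⊆y = IsFaceOf-resp {F′ = Cell y} {P = Cell x}
    ((λ p {q} → proj₂ p {q}) , (λ y⊆z → (λ {q} p → y⊆z (x⊆y p)) , λ {q} → y⊆z {q}))
    ≐-refl (∩-isFace x y)

  -- A point of the face with the fewest critical indices is in its relative interior.
  face-isCell : ∀ {F} y → Satisfiable F → IsFaceOf F (Cell y) → ∃[ x ] F ≐ Cell x
  face-isCell {F} y sat (a , b , valid , F⊆ , ⊆F) with crit-minimal sat
  ... | x , x∈F , minimal = x , (λ {z} → F⊆cell z) , λ {z} → cell⊆F z
    where
    y⊆x : Crit y ⊆ Crit x
    y⊆x = proj₁ (F⊆ x∈F)
    ax≈b : a · x ≈ b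
    ax≈b = proj₂ (F⊆ x∈F)
    -- The origin lies in the cell, so `b ≤ 0`; the point `x + x` lies in it too, so `b ≤ b + b`.
    b≈0 : b ≈ 0#
    b≈0 = antisym
      (≤-respʳ (·-zeroʳ a) (valid 0ᵖ (λ {q} _ → crit-0 q)))
      (≤-respʳ (solve 1 (λ b → b :+ b :- b := b) refl b) (0≤y-x (≤-respʳ
        (trans (·-linearʳ a x 1# x) (+-cong ax≈b (trans (*-identityˡ _) ax≈b)))
        (valid (x +[ 1# ] x) (λ p → crit-+ (proj₁ 0<1) (y⊆x p) (y⊆x p))))))
    F⊆cell : ∀ z → z ∈ F → Crit x ⊆ Crit z
    -- The sum `x + z` is again in `F`, and its critical indices are critical at both `x` and `z`.
    -- Minimality of `x` makes every critical index of `x` one of the sum, hence one of `z`.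
    F⊆cell z z∈F {q} crit = proj₂ (split q (minimal s s∈F (λ {q} p → proj₁ (split q p)) crit))
      where
      s : Point
      s = x +[ 1# ] z
      y⊆z : Crit y ⊆ Crit z
      y⊆z = proj₁ (F⊆ z∈F)
      s∈F : s ∈ F
      s∈F = ⊆F ((λ p → crit-+ (proj₁ 0<1) (y⊆x p) (y⊆z p)) ,
        trans (·-linearʳ a x 1# z) (trans
          (+-cong ax≈b (trans (*-identityˡ _) (trans (proj₂ (F⊆ z∈F)) b≈0))) (+-identityʳ b)))
      split : ∀ q → Crit s q → Crit x q × Crit z q
      split q p with crit-exists y q
      ... | q₀ , same , crit₀ = crit-+⁻ 0<1 same (y⊆x crit₀) (y⊆z crit₀) p
    cell⊆F : ∀ z → Crit x ⊆ Crit z → z ∈ F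
    -- For small `t` the point `x - t z` is still in `Cell y`, because indices critical at `y` tie
    -- at both `x` and `z` with those critical at the new point. Validity there gives `a · z ≤ 0`,
    -- and validity at `z` gives the converse.
    cell⊆F z x⊆z with eventually⇒∃ (eventually-⊆ x (0ᵖ ⊖ z))
    ... | t , 0<t , s⊆x = ⊆F ((λ p → x⊆z (y⊆x p)) , trans az≈0 (sym b≈0))
      where
      s : Point
      s = x +[ t ] (0ᵖ ⊖ z)
      ·s : ∀ c → c · s ≈ c · x - t * (c · z)
      ·s c = trans (·-linearʳ c x t (0ᵖ ⊖ z)) (trans
        (+-congˡ (*-congˡ (trans (·-⊖ c 0ᵖ z) (trans (+-congʳ (·-zeroʳ c)) (+-identityˡ _)))))
        (solve 3 (λ x t z → x :+ t :* (:- z) := x :- t :* z) refl (c · x) t (c · z)))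
      y⊆s : Crit y ⊆ Crit s
      y⊆s {q} p with crit-exists s q
      ... | q₁ , same , crit₁ = crit-≥ same crit₁ (≤-reflexive (trans (·s (χ q₁)) (trans
            (+-cong (crit-≈ same (s⊆x crit₁) (y⊆x p))
                    (-‿cong (*-congˡ (crit-≈ same (x⊆z (s⊆x crit₁)) (x⊆z (y⊆x p))))))
            (sym (·s (χ q))))))
      az≈0 : a · z ≈ 0#
      az≈0 = antisym
        (*-cancelˡ-≤ 0<t (≤-from _ (0≤y-x (≤-respʳ (trans (·s a) (+-congʳ ax≈b)) (valid s y⊆s)))
          (trans (solve 3 (λ b t z → (b :- t :* z) :- b := :- (t :* z)) refl b t (a · z))
            (trans (sym (+-identityˡ _)) (+-congʳ (sym (zeroʳ t)))))))
        (≤-respˡ b≈0 (valid z (λ p → x⊆z (y⊆x p))))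

  -- Semicontinuity puts limit points into the cell. Conversely, for `x` in the cell and any
  -- `t > 0`, the point `x + t c` has exactly the critical indices of `c`, and it approaches `x` as
  -- `t` shrinks.
  closure-isCell : ∀ {S c} → UniqueCrit c → S ≐ (λ y → UniqueCrit y × Crit y ≐ Crit c) → closure S ≐ Cell c
  closure-isCell {S} {c} unique (S⊆ , ⊆S) = (λ {x} → closure⊆ x) , λ {x} → ⊆closure x
    where
    closure⊆ : ∀ x → x ∈ closure S → Crit c ⊆ Crit x
    closure⊆ x x∈ p =
      let r , 0<r , near⇒⊆ = eventually⇒∃ (eventually-near x)
          y , y∈S , near   = x∈ r 0<r
      in near⇒⊆ y near (proj₂ (proj₂ (S⊆ y∈S)) p)
    shift⊆ : ∀ x → Crit c ⊆ Crit x → ∀ {t} → 0# < t → Crit (x +[ t ] c) ⊆ Crit c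
    shift⊆ x c⊆x 0<t {q} p with crit-exists c q
    ... | q₀ , same , crit₀ = proj₂ (crit-+⁻ 0<t same (c⊆x crit₀) crit₀ p)
    ⊆closure : ∀ x → Crit c ⊆ Crit x → x ∈ closure S
    ⊆closure x c⊆x r 0<r =
      let t , 0<t , near = eventually⇒∃ (near-shift x c 0<r)
          ⊆c = shift⊆ x c⊆x 0<t
      in x +[ t ] c ,
         ⊆S ((λ q q′ same p p′ → unique q q′ same (⊆c p) (⊆c p′)) , ⊆c , λ p → crit-+ (proj₁ 0<t) (c⊆x p) p) ,
         near

  -- A relative interior point can be overshot on the segment coming from `x`, which rules out extra
  -- critical indices. Conversely, nearby points of the affine hull gain no critical index.
  relint-cell : ∀ {F x} → F ≐ Cell x → relint F ≐ (λ y → Crit y ≐ Crit x)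
  relint-cell {F} {x} (F⊆ , ⊆F) = (λ {y} → relint⊆ y) , λ {y} → ⊆relint y
    where
    -- If the segment from x to y can be prolonged inside the cell, y has no critical index that x lacks.
    beyond : ∀ y → Crit x ⊆ Crit y → ∀ {t} → 0# < t → Crit x ⊆ Crit (y +[ t ] (y ⊖ x)) → Crit y ⊆ Crit x
    beyond y x⊆y {t} 0<t x⊆s {q} p with crit-exists x q
    ... | q₀ , same , crit₀ = crit-≥ same crit₀ (*-cancelˡ-≤ 0<t (≤-from _
            (0≤y-x (≤-respˡ (·s (χ q)) (≤-respʳ (trans (·s (χ q₀)) (+-cong y₀≈y (*-congˡ (+-congʳ y₀≈y))))
              (maximum (x⊆s crit₀) q (≡.sym same)))))
            (solve 4 (λ y t a b → (y :+ t :* (y :- a)) :- (y :+ t :* (y :- b)) := t :* b :- t :* a)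
              refl (χ q · y) t (χ q₀ · x) (χ q · x))))
      where
      y₀≈y : χ q₀ · y ≈ χ q · y
      y₀≈y = crit-≈ same (x⊆y crit₀) p
      ·s : ∀ c → c · (y +[ t ] (y ⊖ x)) ≈ c · y + t * (c · y - c · x)
      ·s c = trans (·-linearʳ c y t (y ⊖ x)) (+-congˡ (*-congˡ (·-⊖ c y x)))
    relint⊆ : ∀ y → y ∈ relint F → Crit y ≐ Crit x
    relint⊆ y (y∈F , r , 0<r , ball) =
      let t , 0<t , near = eventually⇒∃ (near-shift y (y ⊖ x) 0<r)
      in beyond y (F⊆ y∈F) 0<t (F⊆ (ball _ (affineHull-line y∈F (⊆F (λ p → p)) t) near)) , F⊆ y∈F
    ⊆relint : ∀ y → Crit y ≐ Crit x → y ∈ relint F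
    ⊆relint y (y⊆x , x⊆y) =
      let r , 0<r , near⇒⊆ = eventually⇒∃ (eventually-near y)
      in ⊆F x⊆y , r , 0<r , λ z z∈aff near → ⊆F (x⊆z z z∈aff (λ p → y⊆x (near⇒⊆ z near p)))
      where
      -- Indices of one class that are critical at `x` tie on all of `F`, hence on its affine hull;
      -- one of them being critical at `z` makes all of them so.
      x⊆z : ∀ z → z ∈ affineHull F → Crit z ⊆ Crit x → Crit x ⊆ Crit z
      x⊆z z z∈aff z⊆x {q} p with crit-exists z q
      ... | q₁ , same , crit₁ = crit-≥ same crit₁ (≤-reflexive (x∙y⁻¹≈ε⇒x≈y _ _
            (trans (sym (⊖-· (χ q₁) (χ q) z))
              (affineHull-≈0 (χ q₁ ⊖ χ q) (λ f f∈F → trans (⊖-· (χ q₁) (χ q) f)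
                (x≈y⇒x∙y⁻¹≈ε (crit-≈ same (F⊆ f∈F (z⊆x crit₁)) (F⊆ f∈F p)))) z z∈aff))))

  cells-finite : ∃[ k ] Σ[ f ∈ (Fin k → Point) ] ∀ x → ∃[ i ] Cell x ≐ Cell (f i)
  cells-finite = 2 ℕ.^ N , representative , λ x → code x , covered x
    where
    bit : Point → Fin N → Fin 2
    bit x k with em {Crit x (enum k)}
    ... | yes _ = suc zero
    ... | no  _ = zero
    code : Point → Fin (2 ℕ.^ N)
    code x = funToFin (bit x)
    -- A code realised by no point is sent to the origin, so that every code still names a cell.
    representative : Fin (2 ℕ.^ N) → Point
    representative i with em {∃[ x ] code x ≡ i}
    ... | yes (x , _) = x
    ... | no  _       = 0ᵖ
    code-representative : ∀ x → code (representative (code x)) ≡ code x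
    code-representative x with em {∃[ y ] code y ≡ code x}
    ... | yes (_ , eq) = eq
    ... | no ∄         = ⊥-elim (∄ (x , ≡.refl))
    bit-⊆ : ∀ x y k → bit x k ≡ bit y k → Crit x (enum k) → Crit y (enum k)
    bit-⊆ x y k eq p with em {Crit x (enum k)} | em {Crit y (enum k)}
    ... | _     | yes p′ = p′
    ... | no ¬p | no _   = ⊥-elim (¬p p)
    bit-⊆ x y k () p | yes _ | no _
    code-⊆ : ∀ x y → code x ≡ code y → Crit x ⊆ Crit y
    code-⊆ x y eq {q} p = ≡.subst (Crit y) (enum-index q) (bit-⊆ x y (index-of q)
      (≡.trans (≡.sym (finToFun-funToFin (bit x) (index-of q)))
        (≡.trans (≡.cong (λ i → finToFun i (index-of q)) eq) (finToFun-funToFin (bit y) (index-of q))))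
      (≡.subst (Crit x) (≡.sym (enum-index q)) p))
    covered : ∀ x → Cell x ≐ Cell (representative (code x))
    covered x = (λ x⊆z {q} p → x⊆z (code-⊆ (representative (code x)) x (code-representative x) p)) ,
                (λ r⊆z {q} p → r⊆z (code-⊆ x (representative (code x)) (≡.sym (code-representative x)) p))

-- Acyclicity and the finite enumeration of paths.

module Paths (em : ExcludedMiddle 0ℓ) (G : DAG) where
  open DAG G
  open Classical em

  cycle : ∀ {i j k} → i ⟶ k → Path k j → TransClosure _⟶_ i j
  cycle s ε       = [ s ]
  cycle s (t ◅ π) = s ∷ cycle t π

  path-irreversible : ∀ {i k} → i ⟶ k → ¬ Path k i
  path-irreversible s π = acyclic _ (cycle s π)

  path-antisym : ∀ {i j} → Path i j → Path j i → i ≡ j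
  path-antisym ε       ρ = ≡.refl
  path-antisym (s ◅ π) ρ = ⊥-elim (path-irreversible s (π ◅◅ ρ))

  loop-unique : ∀ {i} (π ρ : Path i i) → π ≡ ρ
  loop-unique ε       ε       = ≡.refl
  loop-unique (s ◅ π) _       = ⊥-elim (path-irreversible s π)
  loop-unique ε       (s ◅ ρ) = ⊥-elim (path-irreversible s ρ)

  AnyPath : Set
  AnyPath = ∃[ i ] ∃[ j ] Path i j

  ends : AnyPath → V × V
  ends (i , j , _) = i , j

  reachable : V → Subset n
  reachable i = toSubset (Path i)

  -- By acyclicity `i` itself is no longer reachable from `k`. The count therefore bounds the length
  -- of paths starting at `i`.
  reachable-< : ∀ {i k} → i ⟶ k → ∣ reachable k ∣ ℕ.< ∣ reachable i ∣
  reachable-< {i} s = p⊂q⇒∣p∣<∣q∣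
    ( (λ v∈ → ∈-toSubset⁺ (s ◅ ∈-toSubset⁻ v∈)) , i , ∈-toSubset⁺ ε
    , λ i∈ → path-irreversible s (∈-toSubset⁻ i∈))

  -- Junk value when the edge does not end where the path starts.
  prepend : Fin m → AnyPath → AnyPath
  prepend e (k , j , π) with proj₂ (edge e) ≟ k
  ... | yes ≡.refl = proj₁ (edge e) , j , (e , ≡.refl) ◅ π
  ... | no  _      = k , j , π

  prepend-◅ : ∀ {i k j} e (eq : edge e ≡ (i , k)) (π : Path k j) →
              prepend e (k , j , π) ≡ (i , j , (e , eq) ◅ π)
  prepend-◅ e ≡.refl π with proj₂ (edge e) ≟ proj₂ (edge e)
  ... | yes ≡.refl = ≡.refl
  ... | no  ≢      = ⊥-elim (≢ ≡.refl)

  trivialPath : V → AnyPath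
  trivialPath i = i , i , ε

  trivialPaths : List AnyPath
  trivialPaths = map trivialPath (allFin n)

  -- The paths with at most `l` edges. Mismatched prepending causes repetitions, which are harmless
  -- since the enumeration only has to be surjective.
  pathsUpTo : ℕ → List AnyPath
  pathsUpTo zero    = trivialPaths
  pathsUpTo (suc l) = trivialPaths ++ cartesianProductWith prepend (allFin m) (pathsUpTo l)

  ∈-pathsUpTo : ∀ l {i j} (π : Path i j) → ∣ reachable i ∣ ℕ.≤ l → (i , j , π) ∈ˡ pathsUpTo l
  ∈-pathsUpTo zero    ε _ = ∈-map⁺ trivialPath (∈-allFin _)
  ∈-pathsUpTo (suc l) ε _ = ∈-++⁺ˡ (∈-map⁺ trivialPath (∈-allFin _))
  ∈-pathsUpTo zero    (s ◅ π) r≤0 = ⊥-elim (ℕ.n≮0 (ℕ.<-≤-trans (reachable-< s) r≤0))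
  ∈-pathsUpTo (suc l) ((e , eq) ◅ π) r≤1+l = ∈-++⁺ʳ trivialPaths
    (≡.subst (_∈ˡ cartesianProductWith prepend (allFin m) (pathsUpTo l)) (prepend-◅ e eq π)
      (∈-cartesianProductWith⁺ prepend (∈-allFin e)
        (∈-pathsUpTo l π (ℕ.≤-pred (ℕ.<-≤-trans (reachable-< (e , eq)) r≤1+l)))))

  allPaths : List AnyPath
  allPaths = pathsUpTo n

  ∈-allPaths : ∀ q → q ∈ˡ allPaths
  ∈-allPaths (i , j , π) = ∈-pathsUpTo n π (∣p∣≤n (reachable i))

  interior-path : ∀ {i j v} (π : Path i j) → v ∈ˡ interior π → (i ≢ v × Path i v) × (v ≢ j × Path v j)
  interior-path (s ◅ π@(t ◅ ρ)) (here ≡.refl) =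
    ((λ { ≡.refl → path-irreversible s ε }) , s ◅ ε) , (λ { ≡.refl → path-irreversible t ρ }) , π
  interior-path (s ◅ π@(_ ◅ _)) (there v∈) with interior-path π v∈
  ... | (_ , kv) , vj = ((λ { ≡.refl → path-irreversible s kv }) , s ◅ kv) , vj

  first⇒interior : ∀ {i k j v} (s : i ⟶ k) (π : Path k j) → v ∈ˡ interior (s ◅ π) → Path k v
  first⇒interior s (_ ◅ _)   (here ≡.refl) = ε
  first⇒interior s π@(_ ◅ _) (there v∈)    = proj₂ (proj₁ (interior-path π v∈))

-- Recovering the critical paths from a generic maxoid.

module Recovery (em : ExcludedMiddle 0ℓ) (ℝ : RealNumbers) (G : DAG) where
  open RealNumbers ℝ hiding (zero)
  open OrderedField em ℝ
  open Solver using (solve; _:=_; _:+_; _:*_; _:-_; :-_)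
  open Classical em
  open DAG G
  open Paths em G
  open Maxoids ℝ G

  critical-tail : ∀ {C i k j} (s : i ⟶ k) (π : Path k j) → Critical C (s ◅ π) → Critical C π
  critical-tail {C} s@(e , _) π crit ρ = ≤-from _ (0≤y-x (crit (s ◅ ρ)))
    (solve 3 (λ c a b → (c :+ a) :- (c :+ b) := a :- b) refl (C e) (ω C π) (ω C ρ))

  generic-unique : ∀ {C i j} → Generic C → i ≢ j → (π ρ : Path i j) → Critical C π → Critical C ρ → π ≡ ρ
  generic-unique {i = i} {j} generic i≢j π ρ critπ critρ with generic i j i≢j π
  ... | _ , _ , unique = ≡.trans (≡.sym (unique {π} critπ)) (unique {ρ} critρ)

  module _ {C C′ i j} (generic : Generic C) (maxoid⊆ : maxoid C′ ⊆ maxoid C) (i≢j : i ≢ j)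
           (π π′ : Path i j) (critical : Critical C π) (critical′ : Critical C′ π′) where

    Below : V → Set
    Below v = ∃[ p ] p ∈ˡ interior π × Path p v

    -- Conditioning on these nodes leaves π open, while any connection other than a direct i → j
    -- needs a parent of i outside of them, a child of j among them, or one of them below π.
    separator : Subset n
    separator = toSubset (λ v → v ≢ i × v ≢ j × Path v j × ¬ Below v)

    π-avoids : CriticalEdge C separator i j
    π-avoids = i≢j , π , avoids
      where
      avoids : ∀ ρ → Critical C ρ → ¬ Any (_∈ˢ separator) (interior ρ)
      avoids ρ crit any with generic-unique generic i≢j ρ π crit critical
      ... | ≡.refl with find any
      ... | v , v∈ , v∈L = proj₂ (proj₂ (proj₂ (∈-toSubset⁻ v∈L))) (v , v∈ , ε)

    -- Otherwise `v` belongs to the separator and blocks `π′`. Then `i` and `j` are separated for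
    -- `C′` but joined by a critical edge for `C`, against `maxoid⊆`.
    interior-below : ∀ {v} → v ∈ˡ interior π′ → Below v
    interior-below {v} v∈π′ with em {Below v}
    ... | yes below = below
    ... | no ¬below = ⊥-elim (proj₂ (proj₂ (proj₂ (maxoid⊆ separated′)))
                        i j (x∈⁅x⁆ i) (x∈⁅x⁆ j) (inj₁ (type-a π-avoids)))
      where
      L : Subset n
      L = separator

      no-edge : ¬ CriticalEdge C′ L i j
      no-edge (_ , _ , avoids) = avoids π′ critical′ (lose v∈π′ v∈L)
        where
        v∈L : v ∈ˢ L
        v∈L with interior-path π′ v∈π′
        ... | (i≢v , _) , v≢j , vj = ∈-toSubset⁺ (i≢v ∘ ≡.sym , v≢j , vj , ¬below)

      no-reverse : ¬ Path j i
      no-reverse ji = i≢j (path-antisym π ji)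

      -- A proper ancestor of `i` reaches `j` through `π`, and lying below the interior of `π` would
      -- close a cycle; so it belongs to the separator.
      no-parent : ∀ {p} → p ∉ˢ L → ¬ CriticalEdge C′ L p i
      no-parent {p} p∉L (p≢i , pi , _) = p∉L (∈-toSubset⁺
        ( p≢i , (λ { ≡.refl → no-reverse pi }) , pi ◅◅ π
        , λ { (u , u∈π , up) → p≢i (path-antisym pi (proj₂ (proj₁ (interior-path π u∈π)) ◅◅ up)) }))

      -- Separator nodes are ancestors of `j`, so none is a proper descendant.
      no-child : ∀ {l} → l ∈ˢ L → ¬ CriticalEdge C′ L j l
      no-child l∈L (j≢l , jl , _) = j≢l (path-antisym jl (proj₁ (proj₂ (proj₂ (∈-toSubset⁻ l∈L)))))

      -- This excludes `j ← p → l ← i`: for `p = i` the edge into `j` is blocked, for `p` below `π`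
      -- so is `l`, and any other `p` would be in the separator.
      no-d : ∀ {p l} → p ∉ˢ L → l ∈ˢ L → CriticalEdge C′ L p j → ¬ CriticalEdge C′ L p l
      no-d {p} {l} p∉L l∈L pj@(p≢j , pathpj , _) (_ , pl , _) with p ≟ i | em {Below p}
      ... | yes ≡.refl | _ = no-edge pj
      ... | no _ | yes (u , u∈π , up) = proj₂ (proj₂ (proj₂ (∈-toSubset⁻ l∈L))) (u , u∈π , up ◅◅ pl)
      ... | no p≢i | no ¬below-p = p∉L (∈-toSubset⁺ (p≢i , p≢j , pathpj , ¬below-p))

      disconnected : ¬ Connected C′ L i j
      disconnected (inj₁ (type-a ij))                          = no-edge ij
      disconnected (inj₁ (type-b p p∉L pi _))                  = no-parent p∉L pi
      disconnected (inj₁ (type-c l l∈L _ jl))                  = no-child l∈L jl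
      disconnected (inj₁ (type-d p l p∉L _ pi _ _))            = no-parent p∉L pi
      disconnected (inj₁ (type-e p l q p∉L _ _ pi _ _ _))      = no-parent p∉L pi
      disconnected (inj₂ (type-a (_ , ji , _)))                = no-reverse ji
      disconnected (inj₂ (type-b p p∉L _ pi))                  = no-parent p∉L pi
      disconnected (inj₂ (type-c l l∈L jl _))                  = no-child l∈L jl
      disconnected (inj₂ (type-d p l p∉L l∈L pj pl _))         = no-d p∉L l∈L pj pl
      disconnected (inj₂ (type-e p l q _ _ q∉L _ _ _ qi))      = no-parent q∉L qi

      separated′ : (⁅ i ⁆ , ⁅ j ⁆ , L) ∈ maxoid C′
      separated′ =
        (λ (v , v∈) → let v∈i , v∈j = x∈p∩q⁻ ⁅ i ⁆ ⁅ j ⁆ v∈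
                      in i≢j (≡.trans (≡.sym (x∈⁅y⁆⇒x≡y i v∈i)) (x∈⁅y⁆⇒x≡y j v∈j))) ,
        (λ (v , v∈) → let v∈i , v∈L = x∈p∩q⁻ ⁅ i ⁆ L v∈
                      in proj₁ (∈-toSubset⁻ v∈L) (x∈⁅y⁆⇒x≡y i v∈i)) ,
        (λ (v , v∈) → let v∈j , v∈L = x∈p∩q⁻ ⁅ j ⁆ L v∈
                      in proj₁ (proj₂ (∈-toSubset⁻ v∈L)) (x∈⁅y⁆⇒x≡y j v∈j)) ,
        (λ i′ j′ i′∈ j′∈ → ≡.subst₂ (λ a b → ¬ Connected C′ L a b)
          (≡.sym (x∈⁅y⁆⇒x≡y i i′∈)) (≡.sym (x∈⁅y⁆⇒x≡y j j′∈)) disconnected)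

  -- Each of the first interior nodes of two critical paths lies below the other, so they agree.
  critical-unique : ∀ {C C′} → Generic C → Generic C′ → maxoid C ≐ maxoid C′ →
                    ∀ {i j} (π π′ : Path i j) → Critical C π → Critical C′ π′ → π ≡ π′
  critical-unique {C} {C′} gen gen′ (M⊆M′ , M′⊆M) = unique
    where
    below : ∀ {i j} → i ≢ j → ∀ (π π′ : Path i j) → Critical C π → Critical C′ π′ →
            ∀ {v} → v ∈ˡ interior π′ → ∃[ p ] p ∈ˡ interior π × Path p v
    below i≢j π π′ = interior-below gen M′⊆M i≢j π π′
    below′ : ∀ {i j} → i ≢ j → ∀ (π π′ : Path i j) → Critical C π → Critical C′ π′ →
             ∀ {v} → v ∈ˡ interior π → ∃[ p ] p ∈ˡ interior π′ × Path p v
    below′ i≢j π π′ crit crit′ = interior-below gen′ M⊆M′ i≢j π′ π crit′ crit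

    irreflexive : ∀ {i k j} → i ⟶ k → Path k j → i ≢ j
    irreflexive s π ≡.refl = path-irreversible s π

    edge-unique : ∀ {i j} (s s′ : i ⟶ j) → s ≡ s′
    edge-unique (e , eq) (e′ , eq′) with edge-inj (≡.trans eq (≡.sym eq′))
    edge-unique (e , ≡.refl) (.e , ≡.refl) | ≡.refl = ≡.refl

    start-at : ∀ {k k′ j} → k′ ≡ k → Path k′ j → Path k j
    start-at {j = j} = ≡.subst (λ v → Path v j)

    ◅-unique : ∀ {i k k′ j} (s : i ⟶ k) (s′ : i ⟶ k′) {π : Path k j} {π′ : Path k′ j} (eq : k′ ≡ k) →
               π ≡ start-at eq π′ → _≡_ {A = Path i j} (s ◅ π) (s′ ◅ π′)
    ◅-unique s s′ ≡.refl ≡.refl = ≡.cong (_◅ _) (edge-unique s s′)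

    critical-start-at : ∀ {D k k′ j} (eq : k′ ≡ k) (π : Path k′ j) → Critical D π → Critical D (start-at eq π)
    critical-start-at ≡.refl π crit = crit

    unique : ∀ {i j} (π π′ : Path i j) → Critical C π → Critical C′ π′ → π ≡ π′
    unique ε       ε        crit crit′ = ≡.refl
    unique ε       (s ◅ π′) crit crit′ = ⊥-elim (path-irreversible s π′)
    unique (s ◅ π) ε        crit crit′ = ⊥-elim (path-irreversible s π)
    unique (s ◅ ε) (s′ ◅ ε) crit crit′ = ≡.cong (_◅ ε) (edge-unique s s′)
    -- A single edge has no interior for the interior of the other path to lie below.
    unique (s ◅ ε) (s′ ◅ π′@(_ ◅ _)) crit crit′
      with below (irreflexive s ε) (s ◅ ε) (s′ ◅ π′) crit crit′ (here ≡.refl)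
    ... | _ , () , _
    unique (s ◅ π@(_ ◅ _)) (s′ ◅ ε) crit crit′
      with below′ (irreflexive s π) (s ◅ π) (s′ ◅ ε) crit crit′ (here ≡.refl)
    ... | _ , () , _
    unique (s ◅ π@(_ ◅ _)) (s′ ◅ π′@(_ ◅ _)) crit crit′ =
      let p  , p∈  , pk′ = below (irreflexive s π) (s ◅ π) (s′ ◅ π′) crit crit′ (here ≡.refl)
          p′ , p′∈ , p′k = below′ (irreflexive s π) (s ◅ π) (s′ ◅ π′) crit crit′ (here ≡.refl)
          k′≡k = path-antisym (first⇒interior s′ π′ p′∈ ◅◅ p′k) (first⇒interior s π p∈ ◅◅ pk′)
      in ◅-unique s s′ k′≡k (unique π (start-at k′≡k π′) (critical-tail s π crit)
           (critical-start-at k′≡k π′ (critical-tail s′ π′ crit′)))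

-- Path weights as linear functionals.

module PathVectors (em : ExcludedMiddle 0ℓ) (ℝ : RealNumbers) (G : DAG) where
  open RealNumbers ℝ hiding (zero)
  open DAG G
  open Paths em G
  open Maxoids ℝ G
  open Points em ℝ m
  open SemiringSum semiring using (sum; sum-cong-≋; sum-replicate-zero)
  open RingProperties ring using (+-cancelˡ)
  open SetoidReasoning setoid

  unit : ∀ {k} → Fin k → Vector Carrier k
  unit zero    zero    = 1#
  unit zero    (suc f) = 0#
  unit (suc e) zero    = 0#
  unit (suc e) (suc f) = unit e f

  unit-≡ : ∀ {k} (e : Fin k) → unit e e ≡ 1#
  unit-≡ zero    = ≡.refl
  unit-≡ (suc e) = unit-≡ e

  unit-≢ : ∀ {k} {e f : Fin k} → e ≢ f → unit e f ≡ 0#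
  unit-≢ {e = zero}  {zero}  e≢f = ⊥-elim (e≢f ≡.refl)
  unit-≢ {e = zero}  {suc f} e≢f = ≡.refl
  unit-≢ {e = suc e} {zero}  e≢f = ≡.refl
  unit-≢ {e = suc e} {suc f} e≢f = unit-≢ (e≢f ∘ ≡.cong suc)

  sum-unit : ∀ {k} (e : Fin k) (x : Vector Carrier k) → sum (λ f → unit e f * x f) ≈ x e
  sum-unit {suc k} zero x = begin
    1# * x zero + sum (λ f → 0# * x (suc f))  ≈⟨ +-cong (*-identityˡ (x zero))
                                                   (sum-cong-≋ (λ f → zeroˡ (x (suc f)))) ⟩
    x zero + sum {k} (λ _ → 0#)               ≈⟨ +-congˡ (sum-replicate-zero k) ⟩
    x zero + 0#                               ≈⟨ +-identityʳ (x zero) ⟩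
    x zero                                    ∎
  sum-unit (suc e) x = begin
    0# * x zero + sum (λ f → unit e f * x (suc f))  ≈⟨ +-cong (zeroˡ (x zero)) (sum-unit e (x ∘ suc)) ⟩
    0# + x (suc e)                                  ≈⟨ +-identityˡ (x (suc e)) ⟩
    x (suc e)                                       ∎

  χ : ∀ {i j} → Path i j → Point
  χ ε             = 0ᵖ
  χ ((e , _) ◅ π) = unit e +[ 1# ] χ π

  χ-ω : ∀ {i j} (π : Path i j) C → χ π · C ≈ ω C π
  χ-ω ε             C = ·-zeroˡ C
  χ-ω ((e , _) ◅ π) C = begin
    (unit e +[ 1# ] χ π) · C        ≈⟨ ·-linearˡ (unit e) 1# (χ π) C ⟩
    unit e · C + 1# * (χ π · C)     ≈⟨ +-cong (sum-unit e C) (trans (*-identityˡ _) (χ-ω π C)) ⟩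
    C e + ω C π                     ∎

  -- A path that uses `e` passes through its source `i`.
  ω-unit-unreachable : ∀ {i k v j} e → edge e ≡ (i , k) → (π : Path v j) → ¬ Path v i → ω (unit e) π ≈ 0#
  ω-unit-unreachable e eq ε              _ = refl
  ω-unit-unreachable e eq ((f , eq′) ◅ π) ¬vi = trans
    (+-cong (reflexive (unit-≢ {e = e} {f} λ { ≡.refl →
              ¬vi (≡.subst (λ u → Path u _) (≡.cong proj₁ (≡.trans (≡.sym eq) eq′)) ε) }))
            (ω-unit-unreachable e eq π (¬vi ∘ ((f , eq′) ◅_))))
    (+-identityʳ 0#)

  -- If the first edges `e` and `e′` differ, the weight concentrated on `e` gives 1 on the first
  -- path and 0 on the second, which cannot return to its start to use `e` later.
  ω-injective : ∀ {i j} (π π′ : Path i j) → (∀ C → ω C π ≈ ω C π′) → π ≡ π′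
  ω-injective ε       ε        _ = ≡.refl
  ω-injective ε       (s ◅ π′) _ = ⊥-elim (path-irreversible s π′)
  ω-injective (s ◅ π) ε        _ = ⊥-elim (path-irreversible s π)
  ω-injective ((e , eq) ◅ π) ((e′ , eq′) ◅ π′) same with e ≟ e′
  ω-injective ((e , ≡.refl) ◅ π) ((.e , ≡.refl) ◅ π′) same | yes ≡.refl =
    ≡.cong ((e , ≡.refl) ◅_) (ω-injective π π′ (λ C → +-cancelˡ (C e) (ω C π) (ω C π′) (same C)))
  ω-injective ((e , eq) ◅ π) ((e′ , eq′) ◅ π′) same | no e≢e′ = ⊥-elim (0≉1 (begin
    0#                        ≈⟨ +-identityʳ 0# ⟨
    0# + 0#                   ≈⟨ +-cong (reflexive (unit-≢ e≢e′))
                                   (ω-unit-unreachable e eq π′ (path-irreversible (e′ , eq′))) ⟨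
    unit e e′ + ω (unit e) π′ ≈⟨ same (unit e) ⟨
    unit e e + ω (unit e) π   ≈⟨ +-cong (reflexive (unit-≡ e))
                                   (ω-unit-unreachable e eq π (path-irreversible (e , eq))) ⟩
    1# + 0#                   ≈⟨ +-identityʳ 1# ⟩
    1#                        ∎))

  χ-separated : ∀ {i j} (π π′ : Path i j) → π ≢ π′ → ∃[ C ] ¬ (χ π · C ≈ χ π′ · C)
  χ-separated π π′ π≢π′ with em {∃[ C ] ¬ (χ π · C ≈ χ π′ · C)}
  ... | yes separated = separated
  ... | no ∄ = ⊥-elim (π≢π′ (ω-injective π π′ same))
    where
    same : ∀ C → ω C π ≈ ω C π′
    same C with em {χ π · C ≈ χ π′ · C}
    ... | yes eq = trans (sym (χ-ω π C)) (trans eq (χ-ω π′ C))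
    ... | no ≉   = ⊥-elim (∄ (C , ≉))

-- The maxoid fan and the map from cones to maxoids.

module MaxoidFan (em : ExcludedMiddle 0ℓ) (ℝ : RealNumbers) (G : DAG) where
  open RealNumbers ℝ using (_≈_; sym)
  open OrderedField em ℝ using (≤-respˡ; ≤-respʳ)
  open DAG G
  open Maxoids ℝ G
  open Faces em ℝ m
  open Paths em G
  open PathVectors em ℝ G
  open Recovery em ℝ G using (generic-unique; critical-unique)

  vector : AnyPath → Point
  vector (_ , _ , π) = χ π

  path-separated : ∀ q q′ → q ≢ q′ → ends q ≡ ends q′ →
                   ∃[ C ] ¬ (vector q · C ≈ vector q′ · C)
  path-separated (i , j , π) (.i , .j , π′) q≢q′ ≡.refl = χ-separated π π′ (q≢q′ ∘ ≡.cong (λ π → i , j , π))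

  path-index : AnyPath → Fin (length allPaths)
  path-index q = index (∈-allPaths q)

  lookup-path-index : ∀ q → lookup allPaths (path-index q) ≡ q
  lookup-path-index q = ≡.sym (lookup-index (∈-allPaths q))

  open Cells em ℝ m (lookup allPaths) path-index lookup-path-index ends vector path-separated
  open Crit

  crit⇒critical : ∀ {C i j} (π : Path i j) → Crit C (i , j , π) → Critical C π
  crit⇒critical {C} π crit π′ = ≤-respˡ (χ-ω π′ C) (≤-respʳ (χ-ω π C) (maximum crit (_ , _ , π′) ≡.refl))

  critical⇒crit : ∀ {C i j} (π : Path i j) → Critical C π → Crit C (i , j , π)
  critical⇒crit {C} π critical = isMax λ { (_ , _ , π′) ≡.refl →
    ≤-respˡ (sym (χ-ω π′ C)) (≤-respʳ (sym (χ-ω π C)) (critical π′)) }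

  unique⇒generic : ∀ {C} → UniqueCrit C → Generic C
  unique⇒generic {C} unique i j i≢j π with crit-exists C (i , j , π)
  ... | (.i , .j , π₀) , ≡.refl , crit₀ = π₀ , crit⇒critical π₀ crit₀ , λ {π′} critical →
    path-≡ (unique (i , j , π₀) (i , j , π′) ≡.refl crit₀ (critical⇒crit π′ critical))
    where
    path-≡ : ∀ {i j} {π π′ : Path i j} → _≡_ {A = AnyPath} (i , j , π) (i , j , π′) → π ≡ π′
    path-≡ ≡.refl = ≡.refl

  generic⇒unique : ∀ {C} → Generic C → UniqueCrit C
  generic⇒unique generic (i , j , π) (.i , .j , π′) ≡.refl crit crit′ with i ≟ j
  -- `Generic` speaks of distinct end points only; for equal ones acyclicity leaves just the trivial
  -- path.
  ... | yes ≡.refl = ≡.cong (λ π → i , i , π) (loop-unique π π′)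
  ... | no i≢j     = ≡.cong (λ π → i , j , π)
    (generic-unique generic i≢j π π′ (crit⇒critical π crit) (crit⇒critical π′ crit′))

  -- With fewer critical paths, fewer have to avoid `L`. The critical DAG grows and the maxoid
  -- shrinks, which is why inclusions get reversed.
  crit⊆⇒edge⊆ : ∀ {x y} → Crit y ⊆ Crit x → ∀ {L i j} → CriticalEdge x L i j → CriticalEdge y L i j
  crit⊆⇒edge⊆ y⊆x (i≢j , π , avoids) = i≢j , π , λ ρ critical →
    avoids ρ (crit⇒critical ρ (y⊆x (critical⇒crit ρ critical)))

  crit⊆⇒connecting⊆ : ∀ {x y} → Crit y ⊆ Crit x → ∀ {L i j} → Connecting x L i j → Connecting y L i j
  crit⊆⇒connecting⊆ {x} {y} y⊆x {L} = go
    where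
    edge⊆ : ∀ {i j} → CriticalEdge x L i j → CriticalEdge y L i j
    edge⊆ = crit⊆⇒edge⊆ {x} {y} y⊆x
    go : ∀ {i j} → Connecting x L i j → Connecting y L i j
    go (type-a ij)                          = type-a (edge⊆ ij)
    go (type-b p p∉ pi pj)                  = type-b p p∉ (edge⊆ pi) (edge⊆ pj)
    go (type-c l l∈ il jl)                  = type-c l l∈ (edge⊆ il) (edge⊆ jl)
    go (type-d p l p∉ l∈ pi pl jl)          = type-d p l p∉ l∈ (edge⊆ pi) (edge⊆ pl) (edge⊆ jl)
    go (type-e p l q p∉ l∈ q∉ pi pl ql qj)  = type-e p l q p∉ l∈ q∉ (edge⊆ pi) (edge⊆ pl) (edge⊆ ql) (edge⊆ qj)

  crit⊆⇒maxoid⊆ : ∀ x y → Crit y ⊆ Crit x → maxoid y ⊆ maxoid x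
  crit⊆⇒maxoid⊆ x y y⊆x (IJ , IL , JL , separated) = IJ , IL , JL , λ i j i∈I j∈J →
    λ { (inj₁ c) → separated i j i∈I j∈J (inj₁ (crit⊆⇒connecting⊆ {x} {y} y⊆x c))
      ; (inj₂ c) → separated i j i∈I j∈J (inj₂ (crit⊆⇒connecting⊆ {x} {y} y⊆x c)) }

  crit≐⇒maxoid≐ : ∀ x y → Crit x ≐ Crit y → maxoid x ≐ maxoid y
  crit≐⇒maxoid≐ x y (x⊆y , y⊆x) =
    crit⊆⇒maxoid⊆ y x x⊆y , crit⊆⇒maxoid⊆ x y y⊆x

  maxoid≐⇒crit⊆ : ∀ C C′ → Generic C → Generic C′ → maxoid C ≐ maxoid C′ → Crit C ⊆ Crit C′
  maxoid≐⇒crit⊆ C C′ gen gen′ M≐M′ {i , j , π} crit with crit-exists C′ (i , j , π)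
  ... | (.i , .j , π′) , ≡.refl , crit′
    with critical-unique {C} {C′} gen gen′ M≐M′ π π′ (crit⇒critical π crit) (crit⇒critical π′ crit′)
  ... | ≡.refl = crit′

  -- Among generic weights, having the maxoid of `C` is the same as having its critical paths.
  closure-cone : ∀ {C} → Generic C → closure (cone C) ≐ Cell C
  closure-cone {C} gen = closure-isCell (generic⇒unique gen)
    ( (λ {C′} (gen′ , M′≐M) → generic⇒unique gen′ ,
        maxoid≐⇒crit⊆ C′ C gen′ gen M′≐M , maxoid≐⇒crit⊆ C C′ gen gen′ (≐-sym M′≐M))
    , λ {C′} (unique , C′≐C) → unique⇒generic unique , crit≐⇒maxoid≐ C′ C C′≐C)

  fan⇒cell : ∀ {F} → F ∈ 𝓕 → ∃[ x ] F ≐ Cell x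
  fan⇒cell (sat , C , gen , face) = face-isCell C sat (IsFaceOf-resp ≐-refl (closure-cone gen) face)

  -- A generic refinement of `x` provides the closed cone of which `Cell x` is a face.
  cell⇒fan : ∀ {F} x → F ≐ Cell x → F ∈ 𝓕
  cell⇒fan x F≐x@(_ , ⊆F) =
    let C , unique , C⊆x = uniqueCrit-refinement x
        gen = unique⇒generic unique
    in (x , ⊆F (λ crit → crit)) , C , gen ,
       IsFaceOf-resp (≐-sym F≐x) (≐-sym (closure-cone gen)) (cell-isFace {C} {x} C⊆x)

  Φ-cell : ∀ {F x} → F ≐ Cell x → Φ F ≐ maxoid x
  Φ-cell {F} {x} F≐x =
    (λ (C , C∈ , t∈) → proj₁ (crit≐⇒maxoid≐ C x (proj₁ (relint-cell F≐x) C∈)) t∈) ,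
    λ t∈ → x , proj₂ (relint-cell F≐x) ≐-refl , t∈

  Φ-cong : ∀ {F F′} → F ∈ 𝓕 → F ≐ F′ → Φ F ≐ Φ F′
  Φ-cong F∈ F≐F′ =
    let x , F≐x = fan⇒cell F∈
    in ≐-trans (Φ-cell F≐x) (≐-sym (Φ-cell (≐-trans (≐-sym F≐F′) F≐x)))

  isCompleteFan : IsCompleteFan 𝓕
  isCompleteFan = record
    { finite     = finite
    ; nonempty   = λ F F∈ → proj₁ F∈
    ; polyhedral = λ F F∈ → let x , F≐x = fan⇒cell F∈ in IsPolyhedralCone-resp (≐-sym F≐x) (cell-isPolyhedral x)
    ; faces      = λ F P P∈ sat face →
        let y , P≐y = fan⇒cell P∈
            x , F≐x = face-isCell y sat (IsFaceOf-resp ≐-refl P≐y face)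
        in cell⇒fan x F≐x
    ; intersect  = λ F F′ F∈ F′∈ → ∩-face F F′ F∈ F′∈ ,
        IsFaceOf-resp ((λ (a , b) → b , a) , (λ (a , b) → b , a)) ≐-refl (∩-face F′ F F′∈ F∈)
    ; covers     = λ x → Cell x , cell⇒fan x ≐-refl , λ crit → crit
    }
    where
    finite : ∃[ k ] Σ[ f ∈ (Fin k → Pred Point 0ℓ) ] (∀ i → f i ∈ 𝓕) × (∀ F → F ∈ 𝓕 → ∃[ i ] F ≐ f i)
    finite = let k , f , covered = cells-finite in
      k , (λ i → Cell (f i)) , (λ i → cell⇒fan (f i) ≐-refl) , λ F F∈ →
        let x , F≐x = fan⇒cell F∈
            i , x≐fi = covered x
        in i , ≐-trans F≐x x≐fi
    ∩-face : ∀ F F′ → F ∈ 𝓕 → F′ ∈ 𝓕 → IsFaceOf (F ∩ᴾ F′) F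
    ∩-face F F′ F∈ F′∈ =
      let x , F⊆x , x⊆F = fan⇒cell F∈
          y , F′⊆y , y⊆F′ = fan⇒cell F′∈
      in IsFaceOf-resp
           ((λ (a , b) → x⊆F a , y⊆F′ b) , (λ (a , b) → F⊆x a , F′⊆y b)) (x⊆F , F⊆x)
           (∩-isFace x y)

  -- The cell of a generic refinement contains `F`, so maximality forces equality.
  maximal⇒generic : ∀ {F} → IsMaximal 𝓕 F → ∃[ C ] Generic C × F ≐ Cell C
  maximal⇒generic {F} (F∈ , maximal) =
    let x , F⊆x , x⊆F = fan⇒cell F∈
        C , unique , C⊆x = uniqueCrit-refinement x
        F⊆C : F ⊆ Cell C
        F⊆C = λ y∈F crit → F⊆x y∈F (C⊆x crit)
    in C , unique⇒generic unique , F⊆C , maximal (Cell C) (cell⇒fan C ≐-refl) F⊆C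

  -- A larger cell is `Cell x` with `Crit x ⊆ Crit C`. Each class has some critical path at `x` and
  -- at most one at `C`, so the two sets agree.
  generic⇒maximal : ∀ {C} → Generic C → IsMaximal 𝓕 (Cell C)
  generic⇒maximal {C} gen = cell⇒fan C ≐-refl , λ F′ F′∈ C⊆F′ →
    let x , F′⊆x , _ = fan⇒cell F′∈
        x⊆C : Crit x ⊆ Crit C
        x⊆C = F′⊆x (C⊆F′ (λ crit → crit))
    in λ y∈F′ crit → F′⊆x y∈F′ (C⊆x x x⊆C crit)
    where
    C⊆x : ∀ x → Crit x ⊆ Crit C → Crit C ⊆ Crit x
    C⊆x x x⊆C {q} crit with crit-exists x q
    ... | q₀ , same , crit₀ = ≡.subst (Crit x) (generic⇒unique gen q₀ q same (x⊆C crit₀) crit) crit₀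

  Φ-bijection : Σ[ β ∈ Bijection (Sets (IsMaximal 𝓕)) (Sets IsGenericMaxoid) ]
                  (∀ F → proj₁ (Bijection.to β F) ≐ Φ (proj₁ F))
  Φ-bijection = record
    { to        = λ (F , max) →
        let C , gen , F≐C = maximal⇒generic max in Φ F , C , gen , Φ-cell F≐C
    ; cong      = λ {(_ , F∈ , _)} F≐F′ → Φ-cong F∈ F≐F′
    ; bijective = (λ {(_ , max)} {(_ , max′)} → injective max max′)
                , λ (M , C , gen , M≐C) → (Cell C , generic⇒maximal gen) , λ F≐C →
                    ≐-trans (Φ-cell F≐C) (≐-sym M≐C)
    } , λ _ → ≐-refl
    where
    -- Both cones are cells of generic weights, whose critical paths are recovered from the common
    -- maxoid.
    injective : ∀ {F F′} → IsMaximal 𝓕 F → IsMaximal 𝓕 F′ → Φ F ≐ Φ F′ → F ≐ F′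
    injective max max′ Φ≐ =
      let C  , gen  , F≐C   = maximal⇒generic max
          C′ , gen′ , F′≐C′ = maximal⇒generic max′
          M≐M′ = ≐-trans (≐-sym (Φ-cell F≐C)) (≐-trans Φ≐ (Φ-cell F′≐C′))
          C≐C′ : Cell C ≐ Cell C′
          C≐C′ = (λ C⊆y crit → C⊆y (maxoid≐⇒crit⊆ C′ C gen′ gen (≐-sym M≐M′) crit))
               , (λ C′⊆y crit → C′⊆y (maxoid≐⇒crit⊆ C C′ gen gen′ M≐M′ crit))
      in ≐-trans F≐C (≐-trans C≐C′ (≐-sym F′≐C′))

  Φ-surjection : Σ[ σ ∈ Surjection (Sets 𝓕) (Sets IsMaxoid) ]
                   (∀ F → proj₁ (Surjection.to σ F) ≐ Φ (proj₁ F))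
  Φ-surjection = record
    { to         = λ (F , F∈) → let x , F≐x = fan⇒cell F∈ in Φ F , x , Φ-cell F≐x
    ; cong       = λ {(_ , F∈)} F≐F′ → Φ-cong F∈ F≐F′
    ; surjective = λ (M , x , M≐x) → (Cell x , cell⇒fan x ≐-refl) , λ F≐x →
        ≐-trans (Φ-cell F≐x) (≐-sym M≐x)
    } , λ _ → ≐-refl

  Φ-wellDefined : ΦWellDefined
  Φ-wellDefined F F∈ =
    let x , F≐x = fan⇒cell F∈
    in (x , proj₂ (relint-cell F≐x) ≐-refl) ,
       λ C C∈ → ≐-trans (Φ-cell F≐x) (≐-sym (crit≐⇒maxoid≐ C x (proj₁ (relint-cell F≐x) C∈)))

  -- The point `x` representing the face lies in the larger cell `Cell y`, so it has at least the
  -- critical paths of `y`.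
  Φ-antitone : ∀ F₁ F₂ → F₁ ∈ 𝓕 → F₂ ∈ 𝓕 → IsFaceOf F₁ F₂ → Φ F₁ ⊇ Φ F₂
  Φ-antitone F₁ F₂ F₁∈ F₂∈ (_ , _ , _ , F₁⊆ , _) t∈ =
    let x , F₁≐x = fan⇒cell F₁∈
        y , F₂≐y = fan⇒cell F₂∈
        y⊆x : Crit y ⊆ Crit x
        y⊆x = proj₁ F₂≐y (proj₁ (F₁⊆ (proj₂ F₁≐x (λ crit → crit))))
    in proj₂ (Φ-cell F₁≐x) (crit⊆⇒maxoid⊆ x y y⊆x (proj₁ (Φ-cell F₂≐y) t∈))

corollary2p13 : ExcludedMiddle 0ℓ → (ℝ : RealNumbers) (G : DAG) →
    let open Maxoids ℝ G in
    IsCompleteFan 𝓕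
    × (Σ[ β ∈ Bijection (Sets (IsMaximal 𝓕)) (Sets IsGenericMaxoid) ]
    (∀ F → proj₁ (Bijection.to β F) ≐ Φ (proj₁ F)))
    × ΦWellDefined
    × (Σ[ σ ∈ Surjection (Sets 𝓕) (Sets IsMaxoid) ]
    (∀ F → proj₁ (Surjection.to σ F) ≐ Φ (proj₁ F)))
    × (∀ F₁ F₂ → F₁ ∈ 𝓕 → F₂ ∈ 𝓕 → IsFaceOf F₁ F₂ → Φ F₁ ⊇ Φ F₂)
corollary2p13 em ℝ G = isCompleteFan , Φ-bijection , Φ-wellDefined , Φ-surjection , Φ-antitone
  where open MaxoidFan em ℝ G
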